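{- Let $h\ge 1$ and let $p_h^U(W)$ be the probability that a growing self-avoiding walk $W$ on $\mathcal G_h$ occurs under the uniform model. Then the generating function $$f_h^U(x,y)=\sum_{W\in W_{(0,h-1)}(\mathcal G_h)}p_h^U(W)\,x^{|W|}y^{\|W\|}$$ that counts GSAWs on $\mathcal G_h$ that start in the top-left corner $(0,h-1)$ by length and displacement is rational.
   Context: $\mathcal G_h$ is the half-infinite grid graph with vertex set $\mathbb N\times\{0,\dots,h-1\}$ ($0\in\mathbb N$), with an edge between two points exactly when they are at Euclidean distance $1$. A growing self-avoiding walk (GSAW) on a graph is a finite directed walk that visits no vertex twice and whose final vertex is trapped, i.e. all of its neighbors are visited by the walk. $W_v(G)$ denotes the set of GSAWs on $G$ starting at the vertex $v$. $|W|$ is the length of $W$ (number of edges) and $\|W\|$ is its displacement (difference between the largest and smallest $x$-coordinates of its vertices). Uniform model: at each step the next vertex is chosen uniformly at random among the not-yet-visited neighbors of the current endpoint; thus $p_h^U(W)$ is the product over the steps of $W$ of $1/m$, where $m$ is the number of unvisited neighbors of the current endpoint just before that step. "Rational" means that the formal power series equals a quotient of two polynomials. -}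

module Defs where

open import Data.Nat.Base as ℕ using (ℕ; zero; suc; z≤n; s≤s; NonZero; ∣_-_∣; _⊔_; _⊓_)
import Data.Nat.Properties as ℕₚ
open import Data.Integer.Base as ℤ using (+_)
open import Data.Rational.Base as ℚ using (ℚ; 0ℚ; 1ℚ)
open import Data.Fin.Base as Fin using (Fin; fromℕ; toℕ)
import Data.Fin.Properties as Finₚ
open import Data.List.Base as List using (List; []; _∷_; upTo; allFin; cartesianProduct; concatMap; filter; length)
open import Data.List.Membership.Propositional using () renaming (_∈_ to _∈ₗ_; lose to loseₗ)
open import Data.List.Membership.Propositional.Properties
import Data.List.Membership.DecPropositional as DecMembershipₗ
import Data.List.Relation.Unary.All as Allₗ
open import Data.List.Relation.Unary.Any using (here)
import Data.List.Relation.Unary.All.Properties as Allₗₚ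
import Data.List.Relation.Unary.AllPairs as AllPairsₗ
import Data.List.Relation.Unary.AllPairs.Properties as AllPairsₗₚ
open import Data.List.Relation.Unary.Unique.Propositional using () renaming (Unique to Uniqueₗ)
import Data.List.Relation.Unary.Unique.Propositional.Properties as Uniqueₗₚ
open import Data.Product using (_×_; _,_; ∃; proj₁; proj₂)
open import Data.Product.Properties using (≡-dec)
open import Data.Vec.Base as Vec using (Vec; []; _∷_; foldr₁)
import Data.Vec.Properties as Vecₚ
open import Data.Vec.Membership.Propositional using (_∈_)
import Data.Vec.Membership.DecPropositional as DecMembership
open import Data.Vec.Relation.Unary.AllPairs using (allPairs?)
open import Data.Vec.Relation.Unary.Linked as Linked using (Linked; [-]; _∷_; linked?)
open import Data.Vec.Relation.Unary.Unique.Propositional using (Unique)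
open import Relation.Binary.Definitions using (DecidableEquality)
open import Relation.Binary.PropositionalEquality
open import Relation.Nullary using (Dec; ¬_; ¬?)
open import Relation.Nullary.Decidable using (map′; _×-dec_)

-- F n m is the coefficient of xⁿyᵐ.
PowerSeries : Set
PowerSeries = ℕ → ℕ → ℚ

infix 4 _≈_
_≈_ : PowerSeries → PowerSeries → Set
F ≈ G = ∀ n m → F n m ≡ G n m

0# : PowerSeries
0# _ _ = 0ℚ

sumℚ : List ℚ → ℚ
sumℚ = List.foldr ℚ._+_ 0ℚ

infixl 7 _·_
_·_ : PowerSeries → PowerSeries → PowerSeries
(F · G) n m =
  sumℚ (List.map (λ i →
    sumℚ (List.map (λ j → F i j ℚ.* G (n ℕ.∸ i) (m ℕ.∸ j)) (upTo (suc m))))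
    (upTo (suc n)))

-- All monomials have total degree below d.
IsPolynomial : PowerSeries → Set
IsPolynomial F = ∃ λ d → ∀ n m → d ℕ.≤ n ℕ.+ m → F n m ≡ 0ℚ

-- F = P / Q, read in the field of fractions of the domain ℚ[[x,y]].
IsRational : PowerSeries → Set
IsRational F = ∃ λ P → ∃ λ Q →
  IsPolynomial P × IsPolynomial Q × ¬ (Q ≈ 0#) × Q · F ≈ P

Vertex : ℕ → Set
Vertex h = ℕ × Fin h

topLeft : ∀ h → .{{NonZero h}} → Vertex h
topLeft (suc k) = 0 , fromℕ k

module _ {h : ℕ} where

  infix 4 _≟ᵥ_
  _≟ᵥ_ : DecidableEquality (Vertex h)
  _≟ᵥ_ = ≡-dec ℕₚ._≟_ Finₚ._≟_

  -- The distance is 1 exactly when its square is.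
  Adj : Vertex h → Vertex h → Set
  Adj (x , y) (x′ , y′) =
    ∣ x - x′ ∣ ℕ.^ 2 ℕ.+ ∣ toℕ y - toℕ y′ ∣ ℕ.^ 2 ≡ 1

  adj? : ∀ u v → Dec (Adj u v)
  adj? (x , y) (x′ , y′) = _ ℕₚ.≟ 1

  -- The box contains every vertex adjacent to v: see ∈-neighbours⁺.
  neighbours : Vertex h → List (Vertex h)
  neighbours v@(x , _) =
    filter (adj? v) (cartesianProduct (upTo (2 ℕ.+ x)) (allFin h))

  sq≤1 : ∀ a b → a ℕ.^ 2 ℕ.+ b ≡ 1 → a ℕ.≤ 1
  sq≤1 zero          b _  = z≤n
  sq≤1 (suc zero)    b _  = s≤s z≤n
  sq≤1 (suc (suc a)) b ()

  x′≤1+x : ∀ x x′ → ∣ x - x′ ∣ ℕ.≤ 1 → x′ ℕ.≤ suc x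
  x′≤1+x x x′ p = ℕₚ.≤-trans (ℕₚ.m≤n+∣n-m∣ x′ x)
    (ℕₚ.≤-trans (ℕₚ.+-monoʳ-≤ x p) (ℕₚ.≤-reflexive (ℕₚ.+-comm x 1)))

  ∈-neighbours⁺ : ∀ v {u} → Adj v u → u ∈ₗ neighbours v
  ∈-neighbours⁺ v@(x , y) {x′ , y′} a = ∈-filter⁺ (adj? v)
    (∈-cartesianProduct⁺ (∈-upTo⁺ (s≤s (x′≤1+x x x′ (sq≤1 _ _ a)))) (∈-allFin y′)) a

  ∈-neighbours⁻ : ∀ v {u} → u ∈ₗ neighbours v → Adj v u
  ∈-neighbours⁻ v@(x , _) p =
    proj₂ (∈-filter⁻ (adj? v) {xs = cartesianProduct (upTo (2 ℕ.+ x)) (allFin h)} p)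

  neighbours-unique : ∀ v → Uniqueₗ (neighbours v)
  neighbours-unique v@(x , _) = Uniqueₗₚ.filter⁺ (adj? v)
    (Uniqueₗₚ.cartesianProduct⁺ (Uniqueₗₚ.upTo⁺ (2 ℕ.+ x)) (Uniqueₗₚ.allFin⁺ h))

  -- A walk with n edges is its vector of n + 1 successive vertices.
  Trapped : ∀ {n} → Vec (Vertex h) (suc n) → Set
  Trapped W = ∀ u → Adj (Vec.last W) u → u ∈ W

  record IsGSAW (v : Vertex h) {n : ℕ} (W : Vec (Vertex h) (suc n)) : Set where
    constructor mkGSAW
    field
      starts       : Vec.head W ≡ v
      walk         : Linked Adj W
      selfAvoiding : Unique W
      trapped      : Trapped W

  displacement : ∀ {n} → Vec (Vertex h) (suc n) → ℕ
  displacement W = foldr₁ _⊔_ (Vec.map proj₁ W) ℕ.∸ foldr₁ _⊓_ (Vec.map proj₁ W)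

  trapped? : ∀ {n} (W : Vec (Vertex h) (suc n)) → Dec (Trapped W)
  trapped? W = map′
    (λ all u a → Allₗ.lookup all (∈-neighbours⁺ (Vec.last W) a))
    (λ t → Allₗ.tabulate λ {u} p → t u (∈-neighbours⁻ (Vec.last W) p))
    (Allₗ.all? (λ u → u ∈? W) (neighbours (Vec.last W)))
    where open DecMembership _≟ᵥ_ using (_∈?_)

  isGSAW? : ∀ v {n} (W : Vec (Vertex h) (suc n)) → Dec (IsGSAW v W)
  isGSAW? v W = map′
    (λ (s , w , a , t) → mkGSAW s w a t)
    (λ (mkGSAW s w a t) → s , w , a , t)
    (Vec.head W ≟ᵥ v ×-dec linked? adj? W
      ×-dec allPairs? (λ u u′ → ¬? (u ≟ᵥ u′)) W ×-dec trapped? W)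

  walks : ∀ n → Vertex h → List (Vec (Vertex h) (suc n))
  walks zero    v = (v ∷ []) ∷ []
  walks (suc n) v = List.map (v ∷_) (concatMap (walks n) (neighbours v))

  -- The GSAWs from v with n edges, each listed exactly once: see ∈-gsaws⁺,
  -- ∈-gsaws⁻ and gsaws-unique.
  gsaws : ∀ n → Vertex h → List (Vec (Vertex h) (suc n))
  gsaws n v = filter (isGSAW? v) (walks n v)

  unvisited : List (Vertex h) → Vertex h → ℕ
  unvisited visited v = length (filter (λ u → ¬? (u ∈? visited)) (neighbours v))
    where open DecMembershipₗ _≟ᵥ_ using (_∈?_)

  -- The value at 0 is irrelevant: just before a step of a self-avoiding walk
  -- the next vertex is itself an unvisited neighbour.
  reciprocal : ℕ → ℚ
  reciprocal zero      = 0ℚ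
  reciprocal m@(suc _) = + 1 ℚ./ m

  -- The list holds the vertices visited before the head of the vector.
  probFrom : List (Vertex h) → ∀ {n} → Vec (Vertex h) (suc n) → ℚ
  probFrom visited (v ∷ [])        = 1ℚ
  probFrom visited (v ∷ W@(_ ∷ _)) =
    reciprocal (unvisited (v ∷ visited) v) ℚ.* probFrom (v ∷ visited) W

  uniformProb : ∀ {n} → Vec (Vertex h) (suc n) → ℚ
  uniformProb = probFrom []

  head-walks : ∀ n {v W} → W ∈ₗ walks n v → Vec.head W ≡ v
  head-walks zero    (here refl) = refl
  head-walks (suc n) p with _ , _ , refl ← ∈-map⁻ (_ ∷_) p = refl

  ∈-walks⁺ : ∀ {n} {W : Vec (Vertex h) (suc n)} →
             Linked Adj W → W ∈ₗ walks n (Vec.head W)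
  ∈-walks⁺ [-] = here refl
  ∈-walks⁺ {W = v ∷ W@(_ ∷ _)} (a ∷ l) =
    ∈-map⁺ (v ∷_) (∈-concatMap⁺ (walks _) (loseₗ (∈-neighbours⁺ v a) (∈-walks⁺ l)))

  walks-unique : ∀ n v → Uniqueₗ (walks n v)
  walks-unique zero    v = Allₗ.[] AllPairsₗ.∷ AllPairsₗ.[]
  walks-unique (suc n) v = Uniqueₗₚ.map⁺ Vecₚ.∷-injectiveʳ
    (Uniqueₗₚ.concat⁺
      (Allₗₚ.map⁺ (Allₗ.universal (walks-unique n) (neighbours v)))
      (AllPairsₗₚ.map⁺ (AllPairsₗ.map
        (λ u≢u′ {_} (p , q) → u≢u′ (trans (sym (head-walks n p)) (head-walks n q)))
        (neighbours-unique v))))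

  ∈-gsaws⁺ : ∀ {n v} {W : Vec (Vertex h) (suc n)} → IsGSAW v W → W ∈ₗ gsaws n v
  ∈-gsaws⁺ {v = v} g@(mkGSAW refl l _ _) = ∈-filter⁺ (isGSAW? v) (∈-walks⁺ l) g

  ∈-gsaws⁻ : ∀ {n v} {W : Vec (Vertex h) (suc n)} → W ∈ₗ gsaws n v → IsGSAW v W
  ∈-gsaws⁻ {n} {v} p = proj₂ (∈-filter⁻ (isGSAW? v) {xs = walks n v} p)

  gsaws-unique : ∀ n v → Uniqueₗ (gsaws n v)
  gsaws-unique n v = Uniqueₗₚ.filter⁺ (isGSAW? v) (walks-unique n v)

-- Only the finitely many GSAWs with n edges and displacement m contribute to
-- the coefficient of xⁿyᵐ.
fᵁ : ∀ h → .{{NonZero h}} → PowerSeries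
fᵁ h n m = sumℚ (List.map uniformProb
  (filter (λ W → displacement W ℕₚ.≟ m) (gsaws n (topLeft h))))

{-# OPTIONS --safe #-}
module Submission where

-- Cut the walk between consecutive columns. Its visits to column 0, in order, each with
-- the direction of the next step and one bit about the right neighbour, form a trace,
-- and since no vertex is repeated there are finitely many relevant traces. Let F s be
-- the generating function of the parts of walks in columns ≥ 0 that leave the trace s,
-- weighted by the probabilities of the steps out of columns ≥ 1. Removing column 0
-- leaves a part of the same kind, and its trace t together with s already determines
-- how the two interleave in time and all degrees on column 1. Hence
-- F s = e s + x^|s| y Σ_t G s t F t with constants e s and G s t, a finite linear system
-- which Gaussian elimination solves by rational functions. Counting walks of displacement
-- < m instead of exactly m costs only a factor 1 - y.

open import Defs
open import Data.Nat.Base using (ℕ; NonZero)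
open import Algebra.Core using (Op₁; Op₂)
open import Algebra.Structures using (IsCommutativeRing)
open import Data.Bool.Base using (Bool; true; false; if_then_else_; _∧_; _∨_; not)
import Data.Bool.Properties as Boolₚ
open import Data.Fin.Base using (Fin; fromℕ; toℕ)
import Data.Fin.Properties as Finₚ
open import Data.List.Base as List using (List; []; _∷_; _++_; map; concatMap; allFin; filter; filterᵇ; length; upTo)
open import Data.List.Membership.Propositional using (_∈_; _∉_; find)
open import Data.List.Membership.Propositional.Properties
  using (∈-allFin; ∈-filter⁺; ∈-filter⁻; ∈-map⁺; ∈-map⁻; ∈-++⁺ʳ; ∈-concatMap⁻)
open import Data.List.Membership.Propositional.Properties.WithK using (unique∧set⇒bag)
import Data.List.Membership.DecPropositional as DecMembership
import Data.List.Properties as Listₚ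
open import Data.List.Relation.Binary.BagAndSetEquality using (∼bag⇒↭)
import Data.List.Relation.Binary.Permutation.Propositional as Perm
open Perm using (_↭_)
open import Data.List.Relation.Binary.Permutation.Propositional.Properties using (filter-↭; ↭-length)
open import Data.List.Relation.Unary.All as All using (All; []; _∷_)
import Data.List.Relation.Unary.All.Properties as Allₚ
open import Data.List.Relation.Unary.AllPairs using ([]; _∷_)
open import Data.List.Relation.Unary.Any using (here; there)
open import Data.List.Relation.Unary.Unique.Propositional using (Unique)
import Data.List.Relation.Unary.Unique.Propositional.Properties as Uniqueₚ
open import Data.Nat.Base as ℕ using (zero; suc; z≤n; s≤s; _≡ᵇ_; _<ᵇ_; _≤_; _<_; ∣_-_∣; _⊔_)
import Data.Nat.Properties as ℕₚ
open import Data.Product using (_×_; _,_; ∃; ∃₂; proj₁; proj₂)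
open import Data.Rational.Base as ℚ using (1ℚ)
import Data.Rational.Properties as ℚₚ
open import Data.Sum.Base using (_⊎_; inj₁; inj₂)
open import Data.Vec.Base as Vec using (Vec; []; _∷_)
open import Data.Vec.Membership.Propositional using () renaming (_∈_ to _∈ᵥ_)
open import Data.Vec.Relation.Unary.All as Allᵥ using ([]; _∷_) renaming (All to Allᵥ)
open import Data.Vec.Relation.Unary.AllPairs using ([]; _∷_)
open import Data.Vec.Relation.Unary.Any using (here; there)
open import Data.Vec.Relation.Unary.Linked using (Linked; [-]; _∷_)
open import Data.Vec.Relation.Unary.Unique.Propositional using () renaming (Unique to Uniqueᵥ)
open import Function.Base using (_∘_; case_of_)
open import Function.Bundles using (mk⇔)
open import Relation.Binary.Definitions using (DecidableEquality)
open import Relation.Binary.PropositionalEquality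
open import Relation.Nullary using (Dec; does; yes; no; contradiction; ¬?)
open import Relation.Nullary.Decidable using (dec-true; dec-false; does-⇔; _×-dec_)
open ≡-Reasoning

-- The obstacle is that step probabilities are not local to a column: the number of free neighbours
-- depends on what has been visited on both sides at that moment. Hence the bit in an item, which
-- tells what the column needs to know about its right side, and hence the delay in weighting: a
-- visit receives its factor only when the column to its left is glued on and all three columns are
-- known. A strict bound on the columns behaves better than the exact displacement, because removing
-- column 0 turns the bound `suc m` into `m` whatever the walk does. This gives every coefficient of
-- the system a factor y, so its matrix has no constant term. All pivots then have constant term 1,
-- and elimination never has to choose one or to divide. The coefficients are an abstract
-- commutative ring and the weight of a step is an arbitrary function `recip` of the degree; the
-- rational numbers and reciprocals are put in only at the end.

module TransferMatrix {K : Set} {_⊕_ _⊗_ : Op₂ K} {⊝_ : Op₁ K} {0ᴷ 1ᴷ : K}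
  (isCommutativeRing : IsCommutativeRing _≡_ _⊕_ _⊗_ ⊝_ 0ᴷ 1ᴷ) where

  open IsCommutativeRing isCommutativeRing
    using (+-assoc; +-comm; +-identityˡ; +-identityʳ; *-assoc; *-comm; *-identityˡ; zeroˡ; zeroʳ;
           distribˡ; distribʳ; -‿inverseˡ)

  infixl 6 _+_
  infixl 7 _*_

  _+_ _*_ : Op₂ K
  _+_ = _⊕_
  _*_ = _⊗_

  -- Finite sums

  private variable
    A B : Set

  ∑ : List A → (A → K) → K
  ∑ xs φ = List.foldr _+_ 0ᴷ (map φ xs)

  guard : Bool → K → K
  guard b q = if b then q else 0ᴷ

  guard-0 : ∀ b → guard b 0ᴷ ≡ 0ᴷ
  guard-0 true  = refl
  guard-0 false = refl

  guard-zero : ∀ b {q} → q ≡ 0ᴷ → guard b q ≡ 0ᴷ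
  guard-zero b refl = guard-0 b

  guard-cong : ∀ b {p q} → (b ≡ true → p ≡ q) → guard b p ≡ guard b q
  guard-cong true  e = e refl
  guard-cong false e = refl

  guard-∧ : ∀ a b q → guard (a ∧ b) q ≡ guard a (guard b q)
  guard-∧ true  b q = refl
  guard-∧ false b q = refl

  *-guard : ∀ p b q → p * guard b q ≡ guard b (p * q)
  *-guard p true  q = refl
  *-guard p false q = zeroʳ p

  guard-* : ∀ b q p → guard b q * p ≡ guard b (q * p)
  guard-* true  q p = refl
  guard-* false q p = zeroˡ p

  ∑-cong : ∀ (xs : List A) {φ ψ} → (∀ x → φ x ≡ ψ x) → ∑ xs φ ≡ ∑ xs ψ
  ∑-cong []       e = refl
  ∑-cong (x ∷ xs) e = cong₂ _+_ (e x) (∑-cong xs e)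

  ∑-cong-∈ : ∀ (xs : List A) {φ ψ} → (∀ x → x ∈ xs → φ x ≡ ψ x) → ∑ xs φ ≡ ∑ xs ψ
  ∑-cong-∈ []       e = refl
  ∑-cong-∈ (x ∷ xs) e = cong₂ _+_ (e x (here refl)) (∑-cong-∈ xs λ x p → e x (there p))

  ∑-zero : ∀ (xs : List A) {φ} → (∀ x → φ x ≡ 0ᴷ) → ∑ xs φ ≡ 0ᴷ
  ∑-zero []       e = refl
  ∑-zero (x ∷ xs) e = trans (cong₂ _+_ (e x) (∑-zero xs e)) (+-identityˡ 0ᴷ)

  swapˡ : ∀ a b c → a + (b + c) ≡ b + (a + c)
  swapˡ a b c = trans (sym (+-assoc a b c)) (trans (cong (_+ c) (+-comm a b)) (+-assoc b a c))

  vanishʳ : ∀ a {b} → b ≡ 0ᴷ → a * b ≡ 0ᴷ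
  vanishʳ a refl = zeroʳ a

  dropˡ : ∀ {a} b → a ≡ 0ᴷ → a + b ≡ b
  dropˡ b refl = +-identityˡ b

  dropʳ : ∀ a {b} → b ≡ 0ᴷ → a + b ≡ a
  dropʳ a refl = +-identityʳ a

  interchange : ∀ a b c d → (a + b) + (c + d) ≡ (a + c) + (b + d)
  interchange a b c d = trans (+-assoc a b _)
    (trans (cong (a +_) (swapˡ b c d)) (sym (+-assoc a c _)))

  ∑-+ : ∀ (xs : List A) φ ψ → ∑ xs (λ x → φ x + ψ x) ≡ ∑ xs φ + ∑ xs ψ
  ∑-+ []       φ ψ = sym (+-identityˡ 0ᴷ)
  ∑-+ (x ∷ xs) φ ψ = trans (cong (_ +_) (∑-+ xs φ ψ)) (interchange (φ x) (ψ x) _ _)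

  ∑-*ˡ : ∀ (xs : List A) c φ → ∑ xs (λ x → c * φ x) ≡ c * ∑ xs φ
  ∑-*ˡ []       c φ = sym (zeroʳ c)
  ∑-*ˡ (x ∷ xs) c φ = trans (cong (_ +_) (∑-*ˡ xs c φ)) (sym (distribˡ c _ _))

  ∑-guard : ∀ (xs : List A) b φ → ∑ xs (λ x → guard b (φ x)) ≡ guard b (∑ xs φ)
  ∑-guard xs true  φ = refl
  ∑-guard xs false φ = ∑-zero xs λ _ → refl

  ∑-++ : ∀ (xs ys : List A) φ → ∑ (xs ++ ys) φ ≡ ∑ xs φ + ∑ ys φ
  ∑-++ []       ys φ = sym (+-identityˡ _)
  ∑-++ (x ∷ xs) ys φ = trans (cong (_ +_) (∑-++ xs ys φ)) (sym (+-assoc (φ x) _ _))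

  ∑-map : ∀ (xs : List A) (f : A → B) φ → ∑ (map f xs) φ ≡ ∑ xs (φ ∘ f)
  ∑-map []       f φ = refl
  ∑-map (x ∷ xs) f φ = cong (_ +_) (∑-map xs f φ)

  ∑-concatMap : ∀ (xs : List A) (f : A → List B) φ →
    ∑ (concatMap f xs) φ ≡ ∑ xs (λ x → ∑ (f x) φ)
  ∑-concatMap []       f φ = refl
  ∑-concatMap (x ∷ xs) f φ =
    trans (∑-++ (f x) (concatMap f xs) φ) (cong (_ +_) (∑-concatMap xs f φ))

  ∑-swap : ∀ (xs : List A) (ys : List B) (φ : A → B → K) →
    ∑ xs (λ x → ∑ ys (φ x)) ≡ ∑ ys (λ y → ∑ xs (λ x → φ x y))
  ∑-swap []       ys φ = sym (∑-zero ys λ _ → refl)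
  ∑-swap (x ∷ xs) ys φ =
    trans (cong (∑ ys (φ x) +_) (∑-swap xs ys φ)) (sym (∑-+ ys (φ x) _))

  ∑-filter : ∀ {P : A → Set} (P? : ∀ x → Dec (P x)) xs φ →
    ∑ (filter P? xs) φ ≡ ∑ xs (λ x → guard (does (P? x)) (φ x))
  ∑-filter P? []       φ = refl
  ∑-filter P? (x ∷ xs) φ with does (P? x)
  ... | true  = cong (_ +_) (∑-filter P? xs φ)
  ... | false = trans (∑-filter P? xs φ) (sym (+-identityˡ _))

  ∑-↭ : ∀ {xs ys : List A} φ → xs ↭ ys → ∑ xs φ ≡ ∑ ys φ
  ∑-↭ φ Perm.refl         = refl
  ∑-↭ φ (Perm.prep x p)   = cong (_ +_) (∑-↭ φ p)
  ∑-↭ φ (Perm.swap x y p) = trans (cong (λ q → φ x + (φ y + q)) (∑-↭ φ p))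
    (swapˡ (φ x) (φ y) _)
  ∑-↭ φ (Perm.trans p q)  = trans (∑-↭ φ p) (∑-↭ φ q)

  module _ (_≟_ : DecidableEquality A) where

    ∑-absent : ∀ {y xs} (φ : A → K) → All (λ x → y ≢ x) xs →
      ∑ xs (λ x → guard (does (y ≟ x)) (φ x)) ≡ 0ᴷ
    ∑-absent φ []      = refl
    ∑-absent {y} {x ∷ xs} φ (n ∷ ns) rewrite dec-false (y ≟ x) n =
      trans (+-identityˡ _) (∑-absent φ ns)

    ∑-single : ∀ {y xs} (φ : A → K) → Unique xs → y ∈ xs →
      ∑ xs (λ x → guard (does (y ≟ x)) (φ x)) ≡ φ y
    ∑-single {y} φ (n ∷ u) (here refl) rewrite dec-true (y ≟ y) refl =
      trans (cong (φ y +_) (∑-absent φ n)) (+-identityʳ _)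
    ∑-single {y} {x ∷ xs} φ (n ∷ u) (there p)
      rewrite dec-false (y ≟ x) (λ e → All.lookup n p (sym e)) =
      trans (+-identityˡ _) (∑-single φ u p)

  -- Rational power series

  -_ : Op₁ K
  -_ = ⊝_

  Series : Set
  Series = ℕ → ℕ → K

  infix 4 _≋_
  _≋_ : Series → Series → Set
  F ≋ G = ∀ n m → F n m ≡ G n m

  infixl 6 _⊞_
  infixl 7 _⊠_

  -- Polynomials are formal expressions acting on series; since the actions commute,
  -- elimination needs no ring laws for the polynomials themselves.
  data Poly : Set where
    con     : K → Poly
    X Y     : Poly
    _⊞_ _⊠_ : Poly → Poly → Poly

  act : Poly → Series → Series
  act (con c) F n       m       = c * F n m
  act X       F zero    m       = 0ᴷ
  act X       F (suc n) m       = F n m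
  act Y       F n       zero    = 0ᴷ
  act Y       F n       (suc m) = F n m
  act (p ⊞ q) F n       m       = act p F n m + act q F n m
  act (p ⊠ q) F                 = act p (act q F)

  constantTerm : Poly → K
  constantTerm (con c) = c
  constantTerm X       = 0ᴷ
  constantTerm Y       = 0ᴷ
  constantTerm (p ⊞ q) = constantTerm p + constantTerm q
  constantTerm (p ⊠ q) = constantTerm p * constantTerm q

  act-00 : ∀ p F → act p F 0 0 ≡ constantTerm p * F 0 0
  act-00 (con c) F = refl
  act-00 X       F = sym (zeroˡ _)
  act-00 Y       F = sym (zeroˡ _)
  act-00 (p ⊞ q) F = trans (cong₂ _+_ (act-00 p F) (act-00 q F)) (sym (distribʳ _ _ _))
  act-00 (p ⊠ q) F = trans (act-00 p (act q F))
    (trans (cong (_ *_) (act-00 q F)) (sym (*-assoc _ _ _)))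

  act-cong : ∀ p {F G} → F ≋ G → act p F ≋ act p G
  act-cong (con c) e n m       = cong (c *_) (e n m)
  act-cong X       e zero m    = refl
  act-cong X       e (suc n) m = e n m
  act-cong Y       e n zero    = refl
  act-cong Y       e n (suc m) = e n m
  act-cong (p ⊞ q) e n m       = cong₂ _+_ (act-cong p e n m) (act-cong q e n m)
  act-cong (p ⊠ q) e           = act-cong p (act-cong q e)

  act-+ : ∀ p F G → act p (λ n m → F n m + G n m) ≋ λ n m → act p F n m + act p G n m
  act-+ (con c) F G n m       = distribˡ c _ _
  act-+ X       F G zero m    = sym (+-identityˡ 0ᴷ)
  act-+ X       F G (suc n) m = refl
  act-+ Y       F G n zero    = sym (+-identityˡ 0ᴷ)
  act-+ Y       F G n (suc m) = refl
  act-+ (p ⊞ q) F G n m       =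
    trans (cong₂ _+_ (act-+ p F G n m) (act-+ q F G n m)) (interchange _ _ _ _)
  act-+ (p ⊠ q) F G n m       =
    trans (act-cong p (act-+ q F G) n m) (act-+ p (act q F) (act q G) n m)

  act-scale : ∀ p c F → act p (λ n m → c * F n m) ≋ λ n m → c * act p F n m
  act-scale (con d) c F n m       =
    trans (sym (*-assoc d c _)) (trans (cong (_* F n m) (*-comm d c)) (*-assoc c d _))
  act-scale X       c F zero m    = sym (zeroʳ c)
  act-scale X       c F (suc n) m = refl
  act-scale Y       c F n zero    = sym (zeroʳ c)
  act-scale Y       c F n (suc m) = refl
  act-scale (p ⊞ q) c F n m       =
    trans (cong₂ _+_ (act-scale p c F n m) (act-scale q c F n m)) (sym (distribˡ c _ _))
  act-scale (p ⊠ q) c F n m       =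
    trans (act-cong p (act-scale q c F) n m) (act-scale p c (act q F) n m)

  act-zero : ∀ p → act p (λ _ _ → 0ᴷ) ≋ λ _ _ → 0ᴷ
  act-zero (con c) n m       = zeroʳ c
  act-zero X       zero m    = refl
  act-zero X       (suc n) m = refl
  act-zero Y       n zero    = refl
  act-zero Y       n (suc m) = refl
  act-zero (p ⊞ q) n m       = trans (cong₂ _+_ (act-zero p n m) (act-zero q n m)) (+-identityˡ 0ᴷ)
  act-zero (p ⊠ q) n m       = trans (act-cong p (act-zero q) n m) (act-zero p n m)

  act-∑ : ∀ {I : Set} p (is : List I) (F : I → Series) →
    act p (λ n m → ∑ is (λ i → F i n m)) ≋ λ n m → ∑ is (λ i → act p (F i) n m)
  act-∑ p []       F     = act-zero p
  act-∑ p (i ∷ is) F n m =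
    trans (act-+ p (F i) _ n m) (cong (act p (F i) n m +_) (act-∑ p is F n m))

  act-X-comm : ∀ p F → act X (act p F) ≋ act p (act X F)
  act-X-comm (con c) F zero    m       = sym (zeroʳ c)
  act-X-comm (con c) F (suc n) m       = refl
  act-X-comm X       F n       m       = refl
  act-X-comm Y       F zero    zero    = refl
  act-X-comm Y       F zero    (suc m) = refl
  act-X-comm Y       F (suc n) zero    = refl
  act-X-comm Y       F (suc n) (suc m) = refl
  act-X-comm (p ⊞ q) F zero    m       =
    trans (sym (+-identityˡ 0ᴷ)) (cong₂ _+_ (act-X-comm p F zero m) (act-X-comm q F zero m))
  act-X-comm (p ⊞ q) F (suc n) m       =
    cong₂ _+_ (act-X-comm p F (suc n) m) (act-X-comm q F (suc n) m)
  act-X-comm (p ⊠ q) F n       m       =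
    trans (act-X-comm p (act q F) n m) (act-cong p (act-X-comm q F) n m)

  act-Y-comm : ∀ p F → act Y (act p F) ≋ act p (act Y F)
  act-Y-comm (con c) F n       zero    = sym (zeroʳ c)
  act-Y-comm (con c) F n       (suc m) = refl
  act-Y-comm X       F n       m       = sym (act-X-comm Y F n m)
  act-Y-comm Y       F n       m       = refl
  act-Y-comm (p ⊞ q) F n       zero    =
    trans (sym (+-identityˡ 0ᴷ)) (cong₂ _+_ (act-Y-comm p F n zero) (act-Y-comm q F n zero))
  act-Y-comm (p ⊞ q) F n       (suc m) =
    cong₂ _+_ (act-Y-comm p F n (suc m)) (act-Y-comm q F n (suc m))
  act-Y-comm (p ⊠ q) F n       m       =
    trans (act-Y-comm p (act q F) n m) (act-cong p (act-Y-comm q F) n m)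

  act-comm : ∀ p q F → act p (act q F) ≋ act q (act p F)
  act-comm (con c)  q F n m = sym (act-scale q c F n m)
  act-comm X        q F n m = act-X-comm q F n m
  act-comm Y        q F n m = act-Y-comm q F n m
  act-comm (p ⊞ p′) q F n m =
    trans (cong₂ _+_ (act-comm p q F n m) (act-comm p′ q F n m)) (sym (act-+ q _ _ n m))
  act-comm (p ⊠ p′) q F n m =
    trans (act-cong p (act-comm p′ q F) n m) (act-comm p q (act p′ F) n m)

  one : Series
  one zero    zero    = 1ᴷ
  one zero    (suc m) = 0ᴷ
  one (suc n) m       = 0ᴷ

  -- Asking for constant term 1 makes the admissible denominators closed under products over any
  -- commutative ring, where being nonzero would not be.
  Rational : Series → Set
  Rational F = ∃₂ λ Q P → constantTerm Q ≡ 1ᴷ × act Q F ≋ act P one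

  rational-act : ∀ p {F} → Rational F → Rational (act p F)
  rational-act p {F} (Q , P , u , e) = Q , p ⊠ P , u ,
    λ n m → trans (act-comm Q p F n m) (act-cong p e n m)

  rational-+ : ∀ {F G} → Rational F → Rational G → Rational (λ n m → F n m + G n m)
  rational-+ {F} {G} (Q , P , u , e) (Q′ , P′ , u′ , e′) =
    Q ⊠ Q′ , (Q′ ⊠ P) ⊞ (Q ⊠ P′) , trans (cong₂ _*_ u u′) (*-identityˡ 1ᴷ) , λ n m → begin
      act Q (act Q′ (λ n m → F n m + G n m)) n m
        ≡⟨ act-cong Q (act-+ Q′ F G) n m ⟩
      act Q (λ n m → act Q′ F n m + act Q′ G n m) n m
        ≡⟨ act-+ Q (act Q′ F) (act Q′ G) n m ⟩
      act Q (act Q′ F) n m + act Q (act Q′ G) n m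
        ≡⟨ cong₂ _+_ (trans (act-comm Q Q′ F n m) (act-cong Q′ e n m)) (act-cong Q e′ n m) ⟩
      act Q′ (act P one) n m + act Q (act P′ one) n m ∎

  rational-∑ : ∀ {I : Set} (is : List I) (F : I → Series) → (∀ i → Rational (F i)) →
    Rational (λ n m → ∑ is (λ i → F i n m))
  rational-∑ []       F r = con 1ᴷ , con 0ᴷ , refl ,
    λ n m → trans (zeroʳ 1ᴷ) (sym (zeroˡ _))
  rational-∑ (i ∷ is) F r = rational-+ (r i) (rational-∑ is F r)

  rational-resp : ∀ {F G} → F ≋ G → Rational F → Rational G
  rational-resp h (Q , P , u , e) = Q , P , u ,
    λ n m → trans (sym (act-cong Q h n m)) (e n m)

  infixl 6 _⊟_
  _⊟_ : Poly → Poly → Poly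
  p ⊟ q = p ⊞ con (- 1ᴷ) ⊠ q

  -1*x+x : ∀ x → (- 1ᴷ) * x + x ≡ 0ᴷ
  -1*x+x x = begin
    (- 1ᴷ) * x + x      ≡⟨ cong ((- 1ᴷ) * x +_) (sym (*-identityˡ x)) ⟩
    (- 1ᴷ) * x + 1ᴷ * x ≡⟨ sym (distribʳ x (- 1ᴷ) 1ᴷ) ⟩
    (- 1ᴷ + 1ᴷ) * x     ≡⟨ cong (_* x) (-‿inverseˡ 1ᴷ) ⟩
    0ᴷ * x              ≡⟨ zeroˡ x ⟩
    0ᴷ                  ∎

  -- Gaussian elimination: the pivot d ⊟ A k k has constant term 1, since A has none.
  linearSystem-rational : ∀ {I : Set} (is : List I) (F : I → Series) d (b : I → Poly) (A : I → I → Poly) →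
    constantTerm d ≡ 1ᴷ → (∀ i j → constantTerm (A i j) ≡ 0ᴷ) →
    (∀ i → act d (F i) ≋ λ n m → act (b i) one n m + ∑ is (λ j → act (A i j) (F j) n m)) →
    ∀ i → Rational (F i)
  -- The equations hold for every index, listed or not. Once all listed unknowns are eliminated,
  -- each equation is therefore already solved, and back-substitution never arises.
  linearSystem-rational []       F d b A u v h i = d , b i , u , λ n m → trans (h i n m) (+-identityʳ _)
  linearSystem-rational (k ∷ is) F d b A u v h   = linearSystem-rational is F (e ⊠ d) b′ A′
    (trans (cong₂ _*_ e-unit u) (*-identityˡ 1ᴷ))
    (λ i j → trans (cong₂ _+_ (trans (cong (_ *_) (v i j)) (zeroʳ _))
                              (trans (cong (_ *_) (v k j)) (zeroʳ _))) (+-identityˡ 0ᴷ))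
    h′
    where
    e  = d ⊟ A k k
    b′ = λ i → e ⊠ b i ⊞ A i k ⊠ b k
    A′ = λ i j → e ⊠ A i j ⊞ A i k ⊠ A k j

    e-unit : constantTerm e ≡ 1ᴷ
    e-unit = trans (cong₂ _+_ u (trans (cong (_ *_) (v k k)) (zeroʳ _))) (+-identityʳ 1ᴷ)

    β = λ i n m → act (b i) one n m
    σ = λ i n m → ∑ is (λ j → act (A i j) (F j) n m)

    pivot : act e (F k) ≋ λ n m → β k n m + σ k n m
    pivot n m = begin
      act d (F k) n m + - 1ᴷ * a       ≡⟨ cong (_+ - 1ᴷ * a) (h k n m) ⟩
      β k n m + (a + σ k n m) + - 1ᴷ * a ≡⟨ cong (_+ - 1ᴷ * a) (swapˡ _ a _) ⟩
      a + (β k n m + σ k n m) + - 1ᴷ * a ≡⟨ +-comm _ _ ⟩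
      - 1ᴷ * a + (a + (β k n m + σ k n m)) ≡⟨ +-assoc _ a _ ⟨
      - 1ᴷ * a + a + (β k n m + σ k n m) ≡⟨ cong (_+ (β k n m + σ k n m)) (-1*x+x a) ⟩
      0ᴷ + (β k n m + σ k n m)         ≡⟨ +-identityˡ _ ⟩
      β k n m + σ k n m                ∎
      where a = act (A k k) (F k) n m

    h′ : ∀ i → act (e ⊠ d) (F i) ≋ λ n m → act (b′ i) one n m + ∑ is (λ j → act (A′ i j) (F j) n m)
    h′ i n m = begin
      act e (act d (F i)) n m
        ≡⟨ act-cong e (h i) n m ⟩
      act e (λ n m → β i n m + (act (A i k) (F k) n m + σ i n m)) n m
        ≡⟨ act-+ e (β i) _ n m ⟩
      act e (β i) n m + act e (λ n m → act (A i k) (F k) n m + σ i n m) n m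
        ≡⟨ cong (act e (β i) n m +_) (act-+ e _ (σ i) n m) ⟩
      act e (β i) n m + (act e (act (A i k) (F k)) n m + act e (σ i) n m)
        -- The factor `e` commutes past `A i k` onto `F k`, where `pivot` replaces the product.
        ≡⟨ cong (λ z → act e (β i) n m + (z + act e (σ i) n m)) (begin
          act e (act (A i k) (F k)) n m ≡⟨ act-comm e (A i k) (F k) n m ⟩
          act (A i k) (act e (F k)) n m ≡⟨ act-cong (A i k) pivot n m ⟩
          act (A i k) (λ n m → β k n m + σ k n m) n m ≡⟨ act-+ (A i k) (β k) (σ k) n m ⟩
          act (A i k) (β k) n m + act (A i k) (σ k) n m ∎) ⟩
      act e (β i) n m + (act (A i k) (β k) n m + act (A i k) (σ k) n m + act e (σ i) n m)
        ≡⟨ cong (act e (β i) n m +_) (+-assoc _ _ _) ⟩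
      act e (β i) n m + (act (A i k) (β k) n m + (act (A i k) (σ k) n m + act e (σ i) n m))
        ≡⟨ +-assoc _ _ _ ⟨
      act (b′ i) one n m + (act (A i k) (σ k) n m + act e (σ i) n m)
        ≡⟨ cong (act (b′ i) one n m +_) (trans (+-comm _ _) (trans
             (cong₂ _+_ (act-∑ e is _ n m) (act-∑ (A i k) is _ n m)) (sym (∑-+ is _ _)))) ⟩
      act (b′ i) one n m + ∑ is (λ j → act (A′ i j) (F j) n m) ∎

  -- Products of series, and formal polynomials as series

  infixl 7 _⊛_
  _⊛_ : Series → Series → Series
  (F ⊛ G) n m = ∑ (upTo (suc n)) λ i → ∑ (upTo (suc m)) λ j → F i j * G (n ℕ.∸ i) (m ℕ.∸ j)

  ⊛-congʳ : ∀ F {G H} → G ≋ H → F ⊛ G ≋ F ⊛ H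
  ⊛-congʳ F e n m = ∑-cong (upTo (suc n)) λ i → ∑-cong (upTo (suc m)) λ j → cong (F i j *_) (e _ _)

  ∑-upTo-suc : ∀ n φ → ∑ (upTo (suc n)) φ ≡ φ 0 + ∑ (upTo n) (φ ∘ suc)
  ∑-upTo-suc n φ = cong (φ 0 +_)
    (trans (cong (λ l → ∑ l φ) (sym (Listₚ.map-upTo suc n))) (∑-map (upTo n) suc φ))

  ⊛-one : ∀ F → one ⊛ F ≋ F
  ⊛-one F n m = begin
    (one ⊛ F) n m
      ≡⟨ ∑-upTo-suc n _ ⟩
    ∑ (upTo (suc m)) (λ j → one 0 j * F n (m ℕ.∸ j)) + ∑ (upTo n) _
      ≡⟨ cong₂ _+_ (∑-upTo-suc m _)
           (∑-zero (upTo n) λ i → ∑-zero (upTo (suc m)) λ j → zeroˡ _) ⟩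
    1ᴷ * F n m + ∑ (upTo m) (λ j → 0ᴷ * F n (m ℕ.∸ suc j)) + 0ᴷ
      ≡⟨ +-identityʳ _ ⟩
    1ᴷ * F n m + ∑ (upTo m) (λ j → 0ᴷ * F n (m ℕ.∸ suc j))
      ≡⟨ cong₂ _+_ (*-identityˡ _) (∑-zero (upTo m) λ j → zeroˡ _) ⟩
    F n m + 0ᴷ
      ≡⟨ +-identityʳ _ ⟩
    F n m ∎

  ⊛-act : ∀ p F G → act p F ⊛ G ≋ act p (F ⊛ G)
  ⊛-act (con c) F G n m = trans
    (∑-cong (upTo (suc n)) λ i → trans (∑-cong (upTo (suc m)) λ j → *-assoc c _ _) (∑-*ˡ (upTo (suc m)) c _))
    (∑-*ˡ (upTo (suc n)) c _)
  ⊛-act X F G zero    m = trans (+-identityʳ _) (∑-zero (upTo (suc m)) λ j → zeroˡ _)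
  ⊛-act X F G (suc n) m = trans (∑-upTo-suc (suc n) _)
    (dropˡ _ (∑-zero (upTo (suc m)) λ j → zeroˡ _))
  ⊛-act Y F G n zero    = ∑-zero (upTo (suc n)) λ i → trans (+-identityʳ _) (zeroˡ _)
  ⊛-act Y F G n (suc m) = ∑-cong (upTo (suc n)) λ i → trans (∑-upTo-suc (suc m) _)
    (dropˡ _ (zeroˡ _))
  ⊛-act (p ⊞ q) F G n m = begin
    (act (p ⊞ q) F ⊛ G) n m
      ≡⟨ (∑-cong (upTo (suc n)) λ i → trans (∑-cong (upTo (suc m)) λ j → distribʳ _ _ _) (∑-+ (upTo (suc m)) _ _)) ⟩
    _ ≡⟨ ∑-+ (upTo (suc n)) _ _ ⟩
    (act p F ⊛ G) n m + (act q F ⊛ G) n m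
      ≡⟨ cong₂ _+_ (⊛-act p F G n m) (⊛-act q F G n m) ⟩
    act (p ⊞ q) (F ⊛ G) n m ∎
  ⊛-act (p ⊠ q) F G n m = trans (⊛-act p (act q F) G n m) (act-cong p (⊛-act q F G) n m)

  -- Links formal polynomials to polynomials as series: `act p one` is the coefficient array of `p`,
  -- and multiplying by it is the action of `p`.
  act-one-⊛ : ∀ p F → act p one ⊛ F ≋ act p F
  act-one-⊛ p F n m = trans (⊛-act p one F n m) (act-cong p (⊛-one F) n m)

  Polynomial : Series → Set
  Polynomial F = ∃ λ d → ∀ n m → d ℕ.≤ n ℕ.+ m → F n m ≡ 0ᴷ

  polynomial-act : ∀ p {F} → Polynomial F → Polynomial (act p F)
  polynomial-act (con c) (d , h) = d , λ n m l → trans (cong (c *_) (h n m l)) (zeroʳ c)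
  polynomial-act X       (d , h) = suc d , λ where
    zero    m l → refl
    (suc n) m l → h n m (ℕₚ.≤-pred l)
  polynomial-act Y       (d , h) = suc d , λ where
    n zero    l → refl
    n (suc m) l → h n m (ℕₚ.≤-pred (subst (suc d ℕ.≤_) (ℕₚ.+-suc n m) l))
  polynomial-act (p ⊞ q) s with polynomial-act p s | polynomial-act q s
  ... | d , h | d′ , h′ = d ℕ.⊔ d′ , λ n m l → trans
    (cong₂ _+_ (h n m (ℕₚ.m⊔n≤o⇒m≤o d d′ l)) (h′ n m (ℕₚ.m⊔n≤o⇒n≤o d d′ l))) (+-identityˡ 0ᴷ)
  polynomial-act (p ⊠ q) s = polynomial-act p (polynomial-act q s)

  polynomial-one : Polynomial one
  polynomial-one = 1 , λ where
    zero    (suc m) l → refl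
    (suc n) m       l → refl

  module _ (recip : ℕ → K) (h : ℕ) where

    -- Walks with a prescribed trace on column 0

    Row Column Grid : Set
    Row    = Fin h
    Column = Row → Bool
    Grid   = ℕ → Column

    data Dir : Set where
      stop left right : Dir
      vert            : Row → Dir

    -- A visit to column 0: its row, the direction of the step that leaves it (left means
    -- out of the region, stop that the walk ends there), and whether the neighbour on its
    -- right had been visited on arrival.
    Item Trace : Set
    Item  = Row × Dir × Bool
    Trace = List Item

    visit : ℕ → Row → Grid → Grid
    visit x y V x′ y′ = ((x ≡ᵇ x′) ∧ does (y Finₚ.≟ y′)) ∨ V x′ y′

    mark : Row → Column → Column
    mark y C y′ = does (y Finₚ.≟ y′) ∨ C y′

    shift : Grid → Grid
    shift V x = V (suc x)

    adjacent? : ∀ (y z : Row) → Dec (∣ toℕ y - toℕ z ∣ ℕ.^ 2 ≡ 1)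
    adjacent? y z = _ ℕₚ.≟ 1

    adjacent : Row → Row → Bool
    adjacent y z = does (adjacent? y z)

    free : Bool → ℕ
    free b = if b then 0 else 1

    verticalDegree : Column → Row → ℕ
    verticalDegree C y = length (filterᵇ (λ z → adjacent y z ∧ not (C z)) (allFin h))

    degree : Column → Bool → Column → Row → ℕ
    degree L r C y = free (L y) ℕ.+ (free r ℕ.+ verticalDegree C y)

    isEmpty : Trace → K
    isEmpty []      = 1ᴷ
    isEmpty (_ ∷ _) = 0ᴷ

    ended : ℕ → Trace → K
    ended zero    s = isEmpty s
    ended (suc _) s = 0ᴷ

    -- enter m n V x y s is the total weight of the ways to step on (x , y), when V is
    -- visited, and continue, n vertices in all, within columns < m, leaving trace s on
    -- column 0. The continuation may leave through the left side of column 0 and come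
    -- back; resume is the weight from such a moment outside. Visits to column 0 are not
    -- weighted, because their degree depends on what lies to the left. For degree 0
    -- every move is blocked, so the value recip 0 is irrelevant.
    mutual
      enter : ℕ → ℕ → Grid → ℕ → Row → Trace → K
      enter m zero    V x       y s                  = 0ᴷ
      enter m (suc n) V zero    y []                 = 0ᴷ
      enter m (suc n) V zero    y ((y′ , δ , b) ∷ s) =
        guard (does (y Finₚ.≟ y′)) (guard (does (V 1 y Boolₚ.≟ b))
          (guard ((0 <ᵇ m) ∧ not (V 0 y)) (depart m n (visit 0 y V) y δ s)))
      enter m (suc n) V (suc x) y s                  =
        guard ((suc x <ᵇ m) ∧ not (V (suc x) y))
          (guard (d ≡ᵇ 0) (ended n s)
            + recip d * (enter m n V⁺ x y s + enter m n V⁺ (2 ℕ.+ x) y s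
                + ∑ (allFin h) λ z → guard (adjacent y z) (enter m n V⁺ (suc x) z s)))
        where
        V⁺ = visit (suc x) y V
        d  = degree (V⁺ x) (V⁺ (2 ℕ.+ x) y) (V⁺ (suc x)) y

      depart : ℕ → ℕ → Grid → Row → Dir → Trace → K
      depart m n V y stop     s = ended n s
      depart m n V y left     s = resume m n V s
      depart m n V y right    s = enter m n V 1 y s
      depart m n V y (vert z) s = guard (adjacent y z) (enter m n V 0 z s)

      resume : ℕ → ℕ → Grid → Trace → K
      resume m n V []            = ended n []
      resume m n V ((y , i) ∷ s) = enter m n V 0 y ((y , i) ∷ s)

    headIs : Row → Trace → Bool
    headIs y []            = false
    headIs y ((y′ , _) ∷ _) = does (y Finₚ.≟ y′)

    bothEmpty : Trace → Trace → K
    bothEmpty s []      = isEmpty s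
    bothEmpty s (_ ∷ _) = 0ᴷ

    -- The interleaving of a trace s on column 0 with a trace t on column 1 is forced: each
    -- left step of t hands over to s and each right step of s hands over to t. The glue
    -- functions follow it, with L and C visited in columns 0 and 1, check that it is
    -- consistent and multiply the weights of the visits to column 1.
    mutual
      glue₀ : Column → Column → Row → Trace → Trace → K
      glue₀ L C y []                 t = 0ᴷ
      glue₀ L C y ((y′ , δ , b) ∷ s) t =
        guard (does (y Finₚ.≟ y′)) (guard (does (C y Boolₚ.≟ b))
          (guard (not (L y)) (glueDepart (mark y L) C y δ s t)))

      glueDepart : Column → Column → Row → Dir → Trace → Trace → K
      glueDepart L C y stop     s t = bothEmpty s t
      glueDepart L C y left     s t = glueResume L C s t
      glueDepart L C y right    s t = guard (headIs y t) (glue₁ L C s t)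
      glueDepart L C y (vert z) s t = guard (adjacent y z) (glue₀ L C z s t)

      glueResume : Column → Column → Trace → Trace → K
      glueResume L C []            t = bothEmpty [] t
      glueResume L C ((y , i) ∷ s) t = glue₀ L C y ((y , i) ∷ s) t

      glue₁ : Column → Column → Trace → Trace → K
      -- Without a further visit to column 1 the walk cannot get back to column 0.
      glue₁ L C s []                = isEmpty s
      glue₁ L C s ((y , δ , b) ∷ t) = glueLeave L (mark y C) y (degree L b (mark y C) y) δ s t

      glueLeave : Column → Column → Row → ℕ → Dir → Trace → Trace → K
      glueLeave L C y d stop     s t = guard (d ≡ᵇ 0) (bothEmpty s t)
      glueLeave L C y d left     s t = recip d * glue₀ L C y s t
      glueLeave L C y d right    s t = recip d * glue₁ L C s t
      -- That the next visit to column 1 is in an adjacent, unvisited row is checked by the other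
      -- factor, the weight of the part with trace `t`.
      glueLeave L C y d (vert _) s t = recip d * glue₁ L C s t

    -- Traces of bounded length and sums over them

    dirs : List Dir
    dirs = stop ∷ left ∷ right ∷ map vert (allFin h)

    itemsAt : Row → Dir → List Item
    itemsAt y δ = (y , δ , true) ∷ (y , δ , false) ∷ []

    items : List Item
    items = concatMap (λ y → concatMap (itemsAt y) dirs) (allFin h)

    traces : ℕ → List Trace
    traces zero    = [] ∷ []
    traces (suc N) = [] ∷ concatMap (λ i → map (i ∷_) (traces N)) items

    ∑-traces-suc : ∀ N φ → ∑ (traces (suc N)) φ ≡
      φ [] + ∑ items (λ i → ∑ (traces N) (λ t → φ (i ∷ t)))
    ∑-traces-suc N φ = cong (φ [] +_) (trans (∑-concatMap items _ φ)
      (∑-cong items λ i → ∑-map (traces N) (i ∷_) φ))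

    ∑-traces-[] : ∀ N φ → (∀ i t → φ (i ∷ t) ≡ 0ᴷ) → ∑ (traces N) φ ≡ φ []
    ∑-traces-[] zero    φ e = +-identityʳ _
    ∑-traces-[] (suc N) φ e = trans (∑-traces-suc N φ)
      (dropʳ _ (∑-zero items λ i → ∑-zero (traces N) (e i)))

    ∑-row : ∀ y φ → ∑ (allFin h) (λ y′ → guard (does (y Finₚ.≟ y′)) (φ y′)) ≡ φ y
    ∑-row y φ = ∑-single Finₚ._≟_ φ (Uniqueₚ.allFin⁺ h) (∈-allFin y)

    -- On arrival the row and the bit of the next item are forced; only the direction of departure
    -- is free.
    ∑-items : ∀ y c (φ : Row → Dir → Bool → K) →
      ∑ items (λ (y′ , δ , b) → guard (does (y Finₚ.≟ y′)) (guard (does (c Boolₚ.≟ b)) (φ y′ δ b)))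
      ≡ ∑ dirs (λ δ → φ y δ c)
    ∑-items y c φ = begin
      ∑ items ψ
        ≡⟨ ∑-concatMap (allFin h) _ ψ ⟩
      _ ≡⟨ (∑-cong (allFin h) λ y′ → trans (∑-concatMap dirs (itemsAt y′) ψ)
             (trans (∑-cong dirs λ δ → bool (does (y Finₚ.≟ y′)) c (φ y′ δ))
                    (∑-guard dirs (does (y Finₚ.≟ y′)) (λ δ → φ y′ δ c)))) ⟩
      _ ≡⟨ ∑-row y (λ y′ → ∑ dirs λ δ → φ y′ δ c) ⟩
      _ ∎
      where
      ψ : Item → K
      ψ (y′ , δ , b) = guard (does (y Finₚ.≟ y′)) (guard (does (c Boolₚ.≟ b)) (φ y′ δ b))

      bool : ∀ p c (ψ : Bool → K) →
        guard p (guard (does (c Boolₚ.≟ true)) (ψ true))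
          + (guard p (guard (does (c Boolₚ.≟ false)) (ψ false)) + 0ᴷ) ≡ guard p (ψ c)
      bool true  true  ψ = dropʳ _ (+-identityˡ 0ᴷ)
      bool true  false ψ = trans (+-identityˡ _) (+-identityʳ _)
      bool false c     ψ = dropʳ _ (+-identityˡ 0ᴷ)

    ∑-dirs : ∀ φ → ∑ dirs φ ≡ φ stop + (φ left + (φ right + ∑ (allFin h) (φ ∘ vert)))
    ∑-dirs φ = cong (λ q → φ stop + (φ left + (φ right + q))) (∑-map (allFin h) vert φ)

    ended-suc : ∀ n i s → ended n (i ∷ s) ≡ 0ᴷ
    ended-suc zero    i s = refl
    ended-suc (suc n) i s = refl

    ∑-ended : ∀ N j s (γ : Trace → K) → γ [] ≡ isEmpty s →
      ∑ (traces N) (λ t → γ t * ended j t) ≡ ended (length s ℕ.+ j) s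
    ∑-ended N j s γ e = begin
      ∑ (traces N) (λ t → γ t * ended j t)
        ≡⟨ ∑-traces-[] N _ (λ i t → trans (cong (_ *_) (ended-suc j i t)) (zeroʳ _)) ⟩
      γ [] * ended j []         ≡⟨ cong (_* ended j []) e ⟩
      isEmpty s * ended j []    ≡⟨ lemma s ⟩
      ended (length s ℕ.+ j) s  ∎
      where
      lemma : ∀ s → isEmpty s * ended j [] ≡ ended (length s ℕ.+ j) s
      lemma []      = *-identityˡ _
      lemma (_ ∷ _) = zeroˡ _

    -- A factor `γ` supported on the empty trace describes a walk that is over: both sides demand
    -- that no item of `s` and none of the `j` vertices is left.
    ∑-resume-[] : ∀ {m} N j V s (γ : Trace → K) → γ [] ≡ isEmpty s → (∀ i t → γ (i ∷ t) ≡ 0ᴷ) →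
      ∑ (traces N) (λ t → γ t * resume m j (shift V) t) ≡ ended (length s ℕ.+ j) s
    ∑-resume-[] {m} N j V s γ e e′ = trans (∑-cong (traces N) λ where
        []      → refl
        (i ∷ t) → trans (trans (cong (_* resume m j (shift V) (i ∷ t)) (e′ i t)) (zeroˡ _))
                        (sym (vanishʳ _ (ended-suc j i t))))
      (∑-ended N j s γ e)

    -- Trades the row of entry for a condition on the trace, so that a crossing into column 1 can be
    -- expressed by the series `resume`, which are indexed by traces alone.
    enter-head : ∀ m j V y t → enter m j V 0 y t ≡ guard (headIs y t) (resume m j V t)
    enter-head m zero    V y []      = refl
    enter-head m zero    V y (i ∷ t) = sym (guard-0 (headIs y (i ∷ t)))
    enter-head m (suc j) V y []      = refl
    enter-head m (suc j) V y ((y′ , δ , b) ∷ t) with y Finₚ.≟ y′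
    ... | no  _    = refl
    ... | yes refl rewrite dec-true (y Finₚ.≟ y) refl = refl

    mutual
      -- Every item of `s` uses up one vertex.
      enter₀-short : ∀ m n V y s → n < length s → enter m n V 0 y s ≡ 0ᴷ
      enter₀-short m zero    V y s                  l       = refl
      enter₀-short m (suc n) V y ((y′ , δ , b) ∷ s) (s≤s l) =
        guard-zero (does (y Finₚ.≟ y′)) (guard-zero (does (V 1 y Boolₚ.≟ b))
          (guard-zero ((0 <ᵇ m) ∧ not (V 0 y)) (depart-short m n (visit 0 y V) y δ s l)))

      depart-short : ∀ m n V y δ s → n < length s → depart m n V y δ s ≡ 0ᴷ
      depart-short m n V y stop     (i ∷ s) l = ended-suc n i s
      depart-short m n V y left     s       l = resume-short m n V s l
      depart-short m n V y right    s       l = enter₁-short m n V 0 y s (ℕₚ.<⇒≤ l)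
      depart-short m n V y (vert z) s       l =
        guard-zero (adjacent y z) (enter₀-short m n V z s l)

      resume-short : ∀ m n V s → n < length s → resume m n V s ≡ 0ᴷ
      resume-short m n V ((y , i) ∷ s) l = enter₀-short m n V y ((y , i) ∷ s) l

      -- The bound is weak here because the vertex being stepped on lies off column 0 and accounts
      -- for no item.
      enter₁-short : ∀ m n V x y s → n ≤ length s → enter m n V (suc x) y s ≡ 0ᴷ
      enter₁-short m zero    V x y s l = refl
      enter₁-short m (suc n) V x y s@(i ∷ s′) l@(s≤s l′) =
        guard-zero ((suc x <ᵇ m) ∧ not (V (suc x) y))
          (trans (dropˡ _ (guard-zero (degree (V⁺ x) (V⁺ (2 ℕ.+ x) y) (V⁺ (suc x)) y ≡ᵇ 0) (ended-suc n i s′)))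
            (vanishʳ _ (trans (dropˡ _ (trans (dropˡ _ (any x)) (enter₁-short m n V⁺ (suc x) y s l″)))
              (∑-zero (allFin h) λ z → guard-zero (adjacent y z) (enter₁-short m n V⁺ x z s l″)))))
        where
        V⁺ = visit (suc x) y V
        l″ = ℕₚ.<⇒≤ l
        any : ∀ x → enter m n V⁺ x y s ≡ 0ᴷ
        any zero    = enter₀-short m n V⁺ y s l
        any (suc x) = enter₁-short m n V⁺ x y s l″

    unmarked : Column → ℕ
    unmarked C = length (filterᵇ (not ∘ C) (allFin h))

    unmarked-mark-≤ : ∀ y C ys → length (filterᵇ (not ∘ mark y C) ys) ≤ length (filterᵇ (not ∘ C) ys)
    unmarked-mark-≤ y C []       = z≤n
    unmarked-mark-≤ y C (z ∷ ys) with does (y Finₚ.≟ z) | C z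
    ... | true  | true  = unmarked-mark-≤ y C ys
    ... | true  | false = ℕₚ.m≤n⇒m≤1+n (unmarked-mark-≤ y C ys)
    ... | false | true  = unmarked-mark-≤ y C ys
    ... | false | false = s≤s (unmarked-mark-≤ y C ys)

    unmarked-mark-< : ∀ {y C ys} → y ∈ ys → C y ≡ false →
      length (filterᵇ (not ∘ mark y C) ys) < length (filterᵇ (not ∘ C) ys)
    unmarked-mark-< {y} {C} {_ ∷ ys} (here refl) e rewrite dec-true (y Finₚ.≟ y) refl | e =
      s≤s (unmarked-mark-≤ y C ys)
    unmarked-mark-< {y} {C} {z ∷ ys} (there p)   e with does (y Finₚ.≟ z) | C z
    ... | true  | true  = unmarked-mark-< {C = C} p e
    ... | true  | false = ℕₚ.m<n⇒m<1+n (unmarked-mark-< {C = C} p e)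
    ... | false | true  = unmarked-mark-< {C = C} p e
    ... | false | false = s≤s (unmarked-mark-< {C = C} p e)

    ∑-*-guard : ∀ {A : Set} (ts : List A) b (γ φ : A → K) →
      ∑ ts (λ t → γ t * guard b (φ t)) ≡ guard b (∑ ts λ t → γ t * φ t)
    ∑-*-guard ts b γ φ = trans (∑-cong ts λ t → *-guard (γ t) b (φ t)) (∑-guard ts b _)

    ∑-guard-* : ∀ {A : Set} (ts : List A) b (γ φ : A → K) →
      ∑ ts (λ t → guard b (γ t) * φ t) ≡ guard b (∑ ts λ t → γ t * φ t)
    ∑-guard-* ts b γ φ = trans (∑-cong ts λ t → guard-* b (γ t) (φ t)) (∑-guard ts b _)

    ∑-*-assoc : ∀ {A : Set} (ts : List A) r (γ φ : A → K) →
      ∑ ts (λ t → (r * γ t) * φ t) ≡ r * (∑ ts λ t → γ t * φ t)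
    ∑-*-assoc ts r γ φ = trans (∑-cong ts λ t → *-assoc r (γ t) (φ t)) (∑-*ˡ ts r _)

    -- A step of `enter` is linear in its continuations, so it commutes with summation against `γ`.
    ∑-*-step : ∀ {A B : Set} (ts : List A) (zs : List B) b c r (a : B → Bool) (γ ε λ′ ρ : A → K) (ω : B → A → K) →
      ∑ ts (λ t → γ t * guard b (guard c (ε t) + r * (λ′ t + ρ t + ∑ zs λ z → guard (a z) (ω z t))))
      ≡ guard b (guard c (∑ ts λ t → γ t * ε t) + r * ((∑ ts λ t → γ t * λ′ t) + (∑ ts λ t → γ t * ρ t)
          + ∑ zs λ z → guard (a z) (∑ ts λ t → γ t * ω z t)))
    ∑-*-step ts zs b c r a γ ε λ′ ρ ω = trans (∑-*-guard ts b γ body) (cong (guard b) (begin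
      ∑ ts (λ t → γ t * (guard c (ε t) + r * _))
        ≡⟨ (∑-cong ts λ t → distribˡ (γ t) _ _) ⟩
      ∑ ts (λ t → γ t * guard c (ε t) + γ t * (r * _))
        ≡⟨ ∑-+ ts _ _ ⟩
      ∑ ts (λ t → γ t * guard c (ε t)) + ∑ ts (λ t → γ t * (r * _))
        ≡⟨ cong₂ _+_ (∑-*-guard ts c γ ε) (trans (∑-cong ts λ t → swap* (γ t) r _) (∑-*ˡ ts r _)) ⟩
      guard c (∑ ts λ t → γ t * ε t) + r * ∑ ts (λ t → γ t * (λ′ t + ρ t + ∑ zs λ z → guard (a z) (ω z t)))
        ≡⟨ cong (λ q → guard c (∑ ts λ t → γ t * ε t) + r * q) (begin
          ∑ ts (λ t → γ t * (λ′ t + ρ t + ∑ zs λ z → guard (a z) (ω z t)))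
            ≡⟨ (∑-cong ts λ t → trans (distribˡ (γ t) _ _) (cong₂ _+_ (distribˡ (γ t) _ _) (sym (∑-*ˡ zs (γ t) _)))) ⟩
          ∑ ts (λ t → γ t * λ′ t + γ t * ρ t + ∑ zs λ z → γ t * guard (a z) (ω z t))
            ≡⟨ trans (∑-+ ts _ _) (cong₂ _+_ (∑-+ ts _ _) (∑-swap ts zs _)) ⟩
          L + R + (∑ zs λ z → ∑ ts λ t → γ t * guard (a z) (ω z t))
            ≡⟨ cong (L + R +_) (∑-cong zs λ z → ∑-*-guard ts (a z) γ (ω z)) ⟩
          _ ∎) ⟩
      _ ∎))
      where
      body = λ t → guard c (ε t) + r * (λ′ t + ρ t + ∑ zs λ z → guard (a z) (ω z t))
      L = ∑ ts λ t → γ t * λ′ t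
      R = ∑ ts λ t → γ t * ρ t
      swap* : ∀ a b c → a * (b * c) ≡ b * (a * c)
      swap* a b c = trans (sym (*-assoc a b c)) (trans (cong (_* c) (*-comm a b)) (*-assoc b a c))

    -- Every item of t visits a new row of column 1, so traces longer than N ≥ unmarked (V 1)
    -- cannot contribute.
    module _ (m : ℕ) where

      mutual
        -- The vertices split into `length s` on column 0, one for each item, and `j` beyond it. The
        -- mutual recursion is well founded because a visit to column 0 shortens `s` while leaving
        -- `j` alone, and a visit further right lowers `j` while leaving `s` alone.
        compose₀ : ∀ N j V y s → unmarked (V 1) ≤ N →
          enter (suc m) (length s ℕ.+ j) V 0 y s
            ≡ ∑ (traces N) (λ t → glue₀ (V 0) (V 1) y s t * resume m j (shift V) t)
        compose₀ N zero    V y [] l = sym (∑-zero (traces N) λ t → zeroˡ _)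
        compose₀ N (suc j) V y [] l = sym (∑-zero (traces N) λ t → zeroˡ _)
        compose₀ N j V y ((y′ , δ , b) ∷ s) l = sym (
          trans (∑-guard-* (traces N) p _ _) (cong (guard p)
          (trans (∑-guard-* (traces N) q _ _) (cong (guard q)
          (trans (∑-guard-* (traces N) r _ _) (cong (guard r)
            (sym (composeDepart N j (visit 0 y V) y δ s l))))))))
          where
          p = does (y Finₚ.≟ y′)
          q = does (V 1 y Boolₚ.≟ b)
          r = not (V 0 y)

        composeDepart : ∀ N j V y δ s → unmarked (V 1) ≤ N →
          depart (suc m) (length s ℕ.+ j) V y δ s
            ≡ ∑ (traces N) (λ t → glueDepart (V 0) (V 1) y δ s t * resume m j (shift V) t)
        composeDepart N j V y stop     s l = sym (∑-resume-[] N j V s (bothEmpty s) refl λ _ _ → refl)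
        composeDepart N j V y left     s l = composeResume N j V s l
        composeDepart N j V y right    s l = trans (compose₁ N j V 0 y s l)
          (∑-cong (traces N) λ t → begin
            γ t * enter m j (shift V) 0 y t                  ≡⟨ cong (γ t *_) (enter-head m j (shift V) y t) ⟩
            γ t * guard (headIs y t) (resume m j (shift V) t) ≡⟨ *-guard (γ t) (headIs y t) _ ⟩
            guard (headIs y t) (γ t * resume m j (shift V) t) ≡⟨ guard-* (headIs y t) (γ t) _ ⟨
            guard (headIs y t) (γ t) * resume m j (shift V) t ∎)
          where γ = glue₁ (V 0) (V 1) s
        composeDepart N j V y (vert z) s l = trans (cong (guard (adjacent y z)) (compose₀ N j V z s l))
          (sym (∑-guard-* (traces N) (adjacent y z) _ _))

        composeResume : ∀ N j V s → unmarked (V 1) ≤ N →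
          resume (suc m) (length s ℕ.+ j) V s
            ≡ ∑ (traces N) (λ t → glueResume (V 0) (V 1) s t * resume m j (shift V) t)
        composeResume N j V []            l = sym (∑-resume-[] N j V [] (bothEmpty []) refl λ _ _ → refl)
        composeResume N j V ((y , i) ∷ s) l = compose₀ N j V y ((y , i) ∷ s) l

        -- The walk is now in the part that survives the removal of column 0, hence `enter` rather
        -- than `resume` in the second factor. The trace `t` is opened only by a visit to column 1.
        compose₁ : ∀ N j V x y s → unmarked (V 1) ≤ N →
          enter (suc m) (length s ℕ.+ j) V (suc x) y s
            ≡ ∑ (traces N) (λ t → glue₁ (V 0) (V 1) s t * enter m j (shift V) x y t)
        -- The items of `s` claim all `length s` vertices, so none is left for the one being stepped
        -- on.
        compose₁ N zero V x y s l = trans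
          (enter₁-short (suc m) (length s ℕ.+ 0) V x y s (ℕₚ.≤-reflexive (ℕₚ.+-identityʳ _)))
          (sym (∑-zero (traces N) λ t → zeroʳ _))
        compose₁ N (suc j) V (suc x) y s l = begin
          enter (suc m) (length s ℕ.+ suc j) V (2 ℕ.+ x) y s
            ≡⟨ cong (λ n → enter (suc m) n V (2 ℕ.+ x) y s) (ℕₚ.+-suc (length s) j) ⟩
          enter (suc m) (suc (length s ℕ.+ j)) V (2 ℕ.+ x) y s
            -- From column 2 on, a degree reads only columns 1 and beyond, so the step is the same
            -- before and after the shift.
            ≡⟨ cong (guard b) (cong₂ (λ u v → guard (d ≡ᵇ 0) u + recip d * v)
                 (sym (∑-ended N j s γ refl))
                 (cong₂ _+_ (cong₂ _+_ (compose₁ N j V⁺ x y s l) (compose₁ N j V⁺ (2 ℕ.+ x) y s l))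
                   (∑-cong (allFin h) λ z → cong (guard (adjacent y z)) (compose₁ N j V⁺ (suc x) z s l)))) ⟩
          _ ≡⟨ ∑-*-step (traces N) (allFin h) b (d ≡ᵇ 0) (recip d) (adjacent y) γ
                 (ended j) (enter m j (shift V⁺) x y) (enter m j (shift V⁺) (2 ℕ.+ x) y)
                 (enter m j (shift V⁺) (suc x)) ⟨
          ∑ (traces N) (λ t → γ t * enter m (suc j) (shift V) (suc x) y t) ∎
          where
          V⁺ = visit (2 ℕ.+ x) y V
          b  = (suc (suc x) <ᵇ suc m) ∧ not (V (suc (suc x)) y)
          d  = degree (V⁺ (suc x)) (V⁺ (3 ℕ.+ x) y) (V⁺ (suc (suc x))) y
          γ  = glue₁ (V 0) (V 1) s
        compose₁ N (suc j) V zero y s l = begin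
          enter (suc m) (length s ℕ.+ suc j) V 1 y s
            ≡⟨ cong (λ n → enter (suc m) n V 1 y s) (ℕₚ.+-suc (length s) j) ⟩
          guard r (guard (d ≡ᵇ 0) (ended n s) + recip d * (enter (suc m) n V⁺ 0 y s + enter (suc m) n V⁺ 2 y s
            + ∑ (allFin h) λ z → guard (adjacent y z) (enter (suc m) n V⁺ 1 z s)))
            ≡⟨ sum N l ⟩
          ∑ (traces N) (λ t → γ t * enter m (suc j) (shift V) 0 y t) ∎
          where
          V⁺ = visit 1 y V
          n  = length s ℕ.+ j
          r  = (0 <ᵇ m) ∧ not (V 1 y)
          d  = degree (V 0) (V 2 y) (V⁺ 1) y
          γ  = glue₁ (V 0) (V 1) s

          r⇒unvisited : r ≡ true → V 1 y ≡ false
          r⇒unvisited e with 0 <ᵇ m | V 1 y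
          ... | true | false = refl

          sum : ∀ N → unmarked (V 1) ≤ N →
            guard r (guard (d ≡ᵇ 0) (ended n s) + recip d * (enter (suc m) n V⁺ 0 y s + enter (suc m) n V⁺ 2 y s
              + ∑ (allFin h) λ z → guard (adjacent y z) (enter (suc m) n V⁺ 1 z s)))
            ≡ ∑ (traces N) (λ t → γ t * enter m (suc j) (shift V) 0 y t)
          -- With `N` zero every row of column 1 is visited, so the step is blocked; on the other
          -- side the empty trace admits no visit.
          sum zero l = trans (guard-cong r λ e → contradiction
              (ℕₚ.<-≤-trans (unmarked-mark-< {C = V 1} (∈-allFin y) (r⇒unvisited e)) l) λ ())
            (trans (guard-0 r) (sym (dropˡ 0ᴷ (zeroʳ (isEmpty s)))))
          sum (suc N) l = sym (begin
            ∑ (traces (suc N)) (λ t → γ t * enter m (suc j) (shift V) 0 y t)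
              ≡⟨ trans (∑-traces-suc N _) (dropˡ _ (zeroʳ (isEmpty s))) ⟩
            ∑ items (λ i → ∑ (traces N) (λ t → γ (i ∷ t) * enter m (suc j) (shift V) 0 y (i ∷ t)))
              ≡⟨ (∑-cong items λ (y′ , δ , b) →
                   trans (∑-*-guard (traces N) (does (y Finₚ.≟ y′)) _ _)
                     (cong (guard (does (y Finₚ.≟ y′))) (∑-*-guard (traces N) (does (V 2 y Boolₚ.≟ b)) _ _))) ⟩
            ∑ items (λ (y′ , δ , b) → guard (does (y Finₚ.≟ y′)) (guard (does (V 2 y Boolₚ.≟ b)) (χ y′ δ b)))
              ≡⟨ ∑-items y (V 2 y) χ ⟩
            ∑ dirs (λ δ → χ y δ (V 2 y))
              ≡⟨ trans (∑-cong dirs λ δ → ∑-*-guard (traces N) r (λ t → γ ((y , δ , V 2 y) ∷ t)) (D δ))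
                       (∑-guard dirs r ξ) ⟩
            guard r (∑ dirs ξ)
              -- The row being visited is new, so marking it lowers `unmarked` and pays for the item
              -- just removed from `t`.
              ≡⟨ guard-cong r (λ e → trans (∑-dirs ξ) (leave (ℕₚ.≤-pred
                   (ℕₚ.<-≤-trans (unmarked-mark-< {C = V 1} (∈-allFin y) (r⇒unvisited e)) l)))) ⟩
            _ ∎)
            where
            D : Dir → Trace → K
            D δ t = depart m j (shift V⁺) y δ t
            χ : Row → Dir → Bool → K
            χ y′ δ b = ∑ (traces N) (λ t → γ ((y′ , δ , b) ∷ t) * guard r (D δ t))
            ξ : Dir → K
            ξ δ = ∑ (traces N) (λ t → glueLeave (V 0) (V⁺ 1) y d δ s t * D δ t)

            -- The directions of the removed item match the terms of `enter`: being trapped, a step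
            -- back to column 0, a step on to column 2, a step within column 1.
            leave : unmarked (V⁺ 1) ≤ N → ξ stop + (ξ left + (ξ right + ∑ (allFin h) (ξ ∘ vert))) ≡
              guard (d ≡ᵇ 0) (ended n s) + recip d * (enter (suc m) n V⁺ 0 y s + enter (suc m) n V⁺ 2 y s
                + ∑ (allFin h) λ z → guard (adjacent y z) (enter (suc m) n V⁺ 1 z s))
            leave l = cong₂ _+_
              (trans (∑-guard-* (traces N) (d ≡ᵇ 0) (bothEmpty s) (ended j))
                (cong (guard (d ≡ᵇ 0)) (∑-ended N j s (bothEmpty s) refl)))
              (begin
                ξ left + (ξ right + ∑ (allFin h) (ξ ∘ vert))
                  ≡⟨ cong₂ _+_ (recurse (compose₀ N j V⁺ y s l)) (cong₂ _+_ (recurse (compose₁ N j V⁺ 1 y s l))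
                      (trans (∑-cong (allFin h) λ z →
                          trans (∑-*-guard (traces N) (adjacent y z) _ _)
                          (trans (cong (guard (adjacent y z)) (recurse (compose₁ N j V⁺ 0 z s l)))
                          (sym (*-guard (recip d) (adjacent y z) _))))
                        (∑-*ˡ (allFin h) (recip d) _))) ⟩
                recip d * E₀ + (recip d * E₂ + recip d * E₁)
                  ≡⟨ +-assoc _ _ _ ⟨
                recip d * E₀ + recip d * E₂ + recip d * E₁
                  ≡⟨ cong (_+ recip d * E₁) (distribˡ (recip d) E₀ E₂) ⟨
                recip d * (E₀ + E₂) + recip d * E₁
                  ≡⟨ distribˡ (recip d) (E₀ + E₂) E₁ ⟨
                recip d * (E₀ + E₂ + E₁) ∎)
              where
              E₀ = enter (suc m) n V⁺ 0 y s
              E₂ = enter (suc m) n V⁺ 2 y s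
              E₁ = ∑ (allFin h) λ z → guard (adjacent y z) (enter (suc m) n V⁺ 1 z s)
              recurse : ∀ {γ φ e} → e ≡ ∑ (traces N) (λ t → γ t * φ t) →
                ∑ (traces N) (λ t → (recip d * γ t) * φ t) ≡ recip d * e
              recurse {γ} {φ} e = trans (∑-*-assoc (traces N) (recip d) γ φ) (cong (recip d *_) (sym e))

    -- The linear system for the trace series

    X^ : ℕ → Poly
    X^ zero    = con 1ᴷ
    X^ (suc k) = X ⊠ X^ k

    act-X^-< : ∀ k F n m → n < k → act (X^ k) F n m ≡ 0ᴷ
    act-X^-< (suc k) F zero    m l       = refl
    act-X^-< (suc k) F (suc n) m (s≤s l) = act-X^-< k F n m l

    act-X^-+ : ∀ k F n m → act (X^ k) F (k ℕ.+ n) m ≡ F n m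
    act-X^-+ zero    F n m = *-identityˡ _
    act-X^-+ (suc k) F n m = act-X^-+ k F n m

    blank : Grid
    blank _ _ = false

    traceSeries : Trace → Series
    traceSeries s n m = resume m n blank s

    unmarked-≤ : ∀ C → unmarked C ≤ h
    unmarked-≤ C = ℕₚ.≤-trans (Listₚ.length-filter _ (allFin h)) (ℕₚ.≤-reflexive (Listₚ.length-tabulate {n = h} _))

    transfer : Trace → Trace → K
    transfer = glueResume (blank 0) (blank 1)

    -- Removing column 0 lowers the number of vertices by `length s` and the bound by 1, which gives
    -- the monomial. At bound 0 only the empty walk with the empty trace is left, which gives the
    -- constant; for larger bounds it is carried along by the factor `Y`.
    traceSeries-recurrence : ∀ s → act (con 1ᴷ) (traceSeries s) ≋ λ n m →
      act (con (isEmpty s)) one n m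
        + ∑ (traces h) (λ t → act (X^ (length s) ⊠ (Y ⊠ con (transfer s t))) (traceSeries t) n m)
    traceSeries-recurrence s n zero = trans (*-identityˡ _)
      (trans (base s n) (sym (dropʳ _ (∑-zero (traces h) λ t → noColumns t n))))
      where
      base : ∀ s n → resume 0 n blank s ≡ isEmpty s * one n 0
      base []      zero    = sym (*-identityˡ 1ᴷ)
      base []      (suc n) = sym (*-identityˡ 0ᴷ)
      base (_ ∷ _) zero    = sym (zeroˡ _)
      base ((y , δ , b) ∷ s) (suc n) = trans
        (guard-zero (does (y Finₚ.≟ y)) (guard-0 (does (false Boolₚ.≟ b)))) (sym (zeroˡ _))
      noColumns : ∀ t n → act (X^ (length s)) (act Y (act (con (transfer s t)) (traceSeries t))) n 0 ≡ 0ᴷ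
      noColumns t n with n ℕₚ.<? length s
      ... | yes l = act-X^-< (length s) _ n 0 l
      ... | no ¬l with ℕₚ.m≤n⇒∃[o]m+o≡n (ℕₚ.≮⇒≥ ¬l)
      ...   | j , refl = act-X^-+ (length s) _ j 0
    traceSeries-recurrence s n (suc m) = trans (*-identityˡ _)
      (trans step (sym (dropˡ _ (trans (cong (isEmpty s *_) (one-suc n)) (zeroʳ _)))))
      where
      one-suc : ∀ n → one n (suc m) ≡ 0ᴷ
      one-suc zero    = refl
      one-suc (suc n) = refl
      step : resume (suc m) n blank s ≡
        ∑ (traces h) (λ t → act (X^ (length s) ⊠ (Y ⊠ con (transfer s t))) (traceSeries t) n (suc m))
      step with n ℕₚ.<? length s
      ... | yes l = trans (resume-short (suc m) n blank s l)
        (sym (∑-zero (traces h) λ t → act-X^-< (length s) _ n (suc m) l))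
      ... | no ¬l with ℕₚ.m≤n⇒∃[o]m+o≡n (ℕₚ.≮⇒≥ ¬l)
      ...   | j , refl = trans (composeResume m h j blank s (unmarked-≤ (blank 1)))
        (∑-cong (traces h) λ t → sym (act-X^-+ (length s) _ j (suc m)))

    traceSeries-rational : ∀ s → Rational (traceSeries s)
    traceSeries-rational = linearSystem-rational (traces h) traceSeries (con 1ᴷ) (λ s → con (isEmpty s))
      (λ s t → X^ (length s) ⊠ (Y ⊠ con (transfer s t))) refl
      -- The factor `Y` removes the constant term, even for the empty trace, where the power of `X`
      -- is 1.
      (λ s t → vanishʳ _ (zeroˡ _)) traceSeries-recurrence

    -- Moving the walk one column to the right of a fully visited column 0 leaves its
    -- weight unchanged and makes compose₁ applicable.
    phantom : Grid
    phantom x _ = x ≡ᵇ 0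

    walkSeries : Row → Series
    walkSeries y n m = enter (suc m) n phantom 1 y []

    walkSeries-rational : ∀ y → Rational (walkSeries y)
    walkSeries-rational y = rational-resp expand
      (rational-∑ (traces h) _ λ t → rational-act (con (c t)) (traceSeries-rational t))
      where
      γ : Trace → K
      γ = glue₁ (phantom 0) (phantom 1) []
      c : Trace → K
      c t = guard (headIs y t) (γ t)
      expand : (λ n m → ∑ (traces h) (λ t → act (con (c t)) (traceSeries t) n m)) ≋ walkSeries y
      expand n m = sym (trans (compose₁ m h n phantom 0 y [] (unmarked-≤ (phantom 1)))
        (∑-cong (traces h) λ t → begin
          γ t * enter m n blank 0 y t                  ≡⟨ cong (γ t *_) (enter-head m n blank y t) ⟩
          γ t * guard (headIs y t) (resume m n blank t) ≡⟨ *-guard (γ t) (headIs y t) _ ⟩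
          guard (headIs y t) (γ t * resume m n blank t) ≡⟨ guard-* (headIs y t) (γ t) _ ⟨
          c t * resume m n blank t                     ∎))

    -- The three conditions say that xy F = (1 - y) Φ. In the application the x appears because Φ
    -- counts vertices and F edges, the y because the bound on the columns in Φ is strict.
    rational-difference : ∀ {F Φ} → Rational Φ →
      (∀ m → Φ 0 m ≡ 0ᴷ) → (∀ n → Φ n 0 ≡ 0ᴷ) →
      (∀ n m → F n m + Φ (suc n) m ≡ Φ (suc n) (suc m)) →
      ∃₂ λ Q P → Polynomial Q × Polynomial P × Q 1 1 ≡ 1ᴷ × Q ⊛ F ≋ P
    rational-difference {F} {Φ} (Q , P , u , e) Φ0- Φ-0 diff =
        act XYQ one , act (D ⊠ P) one
      , polynomial-act XYQ polynomial-one , polynomial-act (D ⊠ P) polynomial-one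
      -- The coefficient of xy in `XYQ` is the constant term of `Q`; it later certifies that the
      -- denominator is not zero.
      , trans (act-00 Q one) (trans (cong (_* 1ᴷ) u) (*-identityˡ 1ᴷ))
      , λ n m → begin
        (act XYQ one ⊛ F) n m       ≡⟨ act-one-⊛ XYQ F n m ⟩
        act (X ⊠ Y) (act Q F) n m   ≡⟨ act-comm (X ⊠ Y) Q F n m ⟩
        act Q (act (X ⊠ Y) F) n m   ≡⟨ act-cong Q shifted n m ⟩
        act Q (act D Φ) n m         ≡⟨ act-comm Q D Φ n m ⟩
        act D (act Q Φ) n m         ≡⟨ act-cong D e n m ⟩
        act D (act P one) n m       ∎
      where
      D   = con 1ᴷ ⊟ Y
      XYQ = (X ⊠ Y) ⊠ Q
      shifted : act (X ⊠ Y) F ≋ act D Φ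
      shifted zero    zero    = sym (trans (dropʳ _ (zeroʳ _)) (vanishʳ _ (Φ0- 0)))
      shifted zero    (suc m) = sym (trans (dropʳ _ (vanishʳ _ (Φ0- m))) (vanishʳ _ (Φ0- (suc m))))
      shifted (suc n) zero    = sym (trans (dropʳ _ (zeroʳ _)) (vanishʳ _ (Φ-0 (suc n))))
      shifted (suc n) (suc m) = sym (begin
        1ᴷ * Φ (suc n) (suc m) + - 1ᴷ * a   ≡⟨ cong (_+ - 1ᴷ * a) (trans (*-identityˡ _) (sym (diff n m))) ⟩
        F n m + a + - 1ᴷ * a                ≡⟨ +-assoc _ _ _ ⟩
        F n m + (a + - 1ᴷ * a)              ≡⟨ dropʳ _ (trans (+-comm _ _) (-1*x+x a)) ⟩
        F n m                               ∎)
        where a = Φ (suc n) m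

    open DecMembership (_≟ᵥ_ {h}) using (_∈?_)

    -- Comparison with growing self-avoiding walks

    leftOf : Vertex h → List (Vertex h)
    leftOf (zero  , y) = []
    leftOf (suc x , y) = (x , y) ∷ []

    verticals : Vertex h → List (Vertex h)
    verticals (x , y) = map (x ,_) (filter (adjacent? y) (allFin h))

    -- The neighbours in the order in which `enter` adds up the moves: left, right, vertical.
    star : Vertex h → List (Vertex h)
    star v@(x , y) = leftOf v ++ (suc x , y) ∷ verticals v

    ∣n-1+n∣≡1 : ∀ x → ∣ x - suc x ∣ ≡ 1
    ∣n-1+n∣≡1 zero    = refl
    ∣n-1+n∣≡1 (suc x) = ∣n-1+n∣≡1 x

    ∣1+n-n∣≡1 : ∀ x → ∣ suc x - x ∣ ≡ 1
    ∣1+n-n∣≡1 zero    = refl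
    ∣1+n-n∣≡1 (suc x) = ∣1+n-n∣≡1 x

    ∣m-n∣≡1 : ∀ x x′ → ∣ x - x′ ∣ ≡ 1 → x′ ≡ suc x ⊎ x ≡ suc x′
    ∣m-n∣≡1 zero       (suc zero) e = inj₁ refl
    ∣m-n∣≡1 (suc zero) zero       e = inj₂ refl
    ∣m-n∣≡1 (suc x)    (suc x′)   e with ∣m-n∣≡1 x x′ e
    ... | inj₁ refl = inj₁ refl
    ... | inj₂ refl = inj₂ refl

    n²≡0 : ∀ n → n ℕ.^ 2 ≡ 0 → n ≡ 0
    n²≡0 zero e = refl

    ∈-verticals⁻ : ∀ {v u} → u ∈ verticals v → Adj v u
    ∈-verticals⁻ {x , y} p with ∈-map⁻ (x ,_) p
    ... | z , q , refl rewrite ℕₚ.∣n-n∣≡0 x = proj₂ (∈-filter⁻ (adjacent? y) {xs = allFin h} q)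

    ∈-star⁻ : ∀ {v u} → u ∈ star v → Adj v u
    ∈-star⁻ {zero  , y} (here refl) rewrite ℕₚ.∣n-n∣≡0 (toℕ y) = refl
    ∈-star⁻ {zero  , y} (there p)   = ∈-verticals⁻ {zero , y} p
    ∈-star⁻ {suc x , y} (here refl) rewrite ∣1+n-n∣≡1 x | ℕₚ.∣n-n∣≡0 (toℕ y) = refl
    ∈-star⁻ {suc x , y} (there (here refl)) rewrite ∣n-1+n∣≡1 x | ℕₚ.∣n-n∣≡0 (toℕ y) = refl
    ∈-star⁻ {suc x , y} (there (there p))   = ∈-verticals⁻ {suc x , y} p

    ∈-star⁺ : ∀ {v u} → Adj v u → u ∈ star v
    ∈-star⁺ {x , y} {x′ , y′} a with ∣ x - x′ ∣ in e
    ... | zero with refl ← ℕₚ.∣m-n∣≡0⇒m≡n {x} {x′} e =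
      ∈-++⁺ʳ (leftOf (x , y)) (there (∈-map⁺ (x ,_) (∈-filter⁺ (adjacent? y) (∈-allFin y′) a)))
    ... | suc (suc d) with () ← a
    ... | suc zero with refl ← Finₚ.toℕ-injective (ℕₚ.∣m-n∣≡0⇒m≡n {toℕ y} {toℕ y′} (n²≡0 _ (ℕₚ.suc-injective a)))
      with ∣m-n∣≡1 x x′ e
    ...   | inj₁ refl = ∈-++⁺ʳ (leftOf (x , y)) (here refl)
    ...   | inj₂ refl = here refl

    star-unique : ∀ v → Unique (star v)
    star-unique v@(x , y) = ++ˡ x (suc-fresh x ∷ vertical-unique x)
      where
      vertical-unique : ∀ x → Unique (verticals (x , y))
      vertical-unique x = Uniqueₚ.map⁺ (cong proj₂) (Uniqueₚ.filter⁺ _ (Uniqueₚ.allFin⁺ h))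
      fresh : ∀ {x x′} → x′ ≢ x → All ((x′ , y) ≢_) (verticals (x , y))
      fresh n = Allₚ.map⁺ (All.universal (λ z e → n (cong proj₁ e)) _)
      suc-fresh : ∀ x → All ((suc x , y) ≢_) (verticals (x , y))
      suc-fresh x = fresh ℕₚ.1+n≢n
      ++ˡ : ∀ x → Unique ((suc x , y) ∷ verticals (x , y)) → Unique (star (x , y))
      ++ˡ zero    u = u
      ++ˡ (suc x) u = ((λ ()) ∷ fresh (ℕₚ.1+n≢n ∘ sym)) ∷ u

    neighbours↭star : ∀ v → neighbours v ↭ star v
    neighbours↭star v = ∼bag⇒↭ (unique∧set⇒bag (neighbours-unique v) (star-unique v)
      (mk⇔ (λ p → ∈-star⁺ {v} (∈-neighbours⁻ v p)) (λ p → ∈-neighbours⁺ v (∈-star⁻ {v} p))))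

    ∑-neighbours : ∀ x y (φ : Vertex h → K) → ∑ (neighbours (x , y)) φ ≡
      ∑ (leftOf (x , y)) φ + (φ (suc x , y) + ∑ (allFin h) λ z → guard (adjacent y z) (φ (x , z)))
    ∑-neighbours x y φ = trans (∑-↭ φ (neighbours↭star (x , y))) (trans (∑-++ (leftOf (x , y)) _ φ)
      (cong (λ q → ∑ (leftOf (x , y)) φ + (φ (suc x , y) + q))
        (trans (∑-map (filter (adjacent? y) (allFin h)) (x ,_) φ) (∑-filter (adjacent? y) (allFin h) (φ ∘ (x ,_))))))

    -- V is shifted by one column, so that its column 0 can hold the phantom wall.
    record Records (vs : List (Vertex h)) (V : Grid) : Set where
      field
        wall  : ∀ y → V 0 y ≡ true
        inner : ∀ x y → V (suc x) y ≡ does ((x , y) ∈? vs)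
    open Records

    records-visit : ∀ {vs V} x y → Records vs V → Records ((x , y) ∷ vs) (visit (suc x) y V)
    records-visit x y R .wall          = R .wall
    records-visit {vs} x y R .inner x′ y′ = cong₂ _∨_
      (does-⇔ (mk⇔ (λ (p , q) → cong₂ _,_ (sym p) (sym q)) λ e → sym (cong proj₁ e) , sym (cong proj₂ e))
        ((x ℕₚ.≟ x′) ×-dec (y Finₚ.≟ y′)) ((x′ , y′) ≟ᵥ (x , y)))
      (R .inner x′ y′)

    unvisited-degree : ∀ {vs V} → Records vs V → ∀ x y →
      unvisited vs (x , y) ≡ degree (V x) (V (2 ℕ.+ x) y) (V (suc x)) y
    unvisited-degree {vs} {V} R x y = begin
      unvisited vs (x , y)
        ≡⟨ ↭-length (filter-↭ new? (neighbours↭star (x , y))) ⟩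
      length (filter new? (star (x , y)))
        ≡⟨ trans (cong length (Listₚ.filter-++ new? (leftOf (x , y)) _)) (Listₚ.length-++ (filter new? (leftOf (x , y)))) ⟩
      length (filter new? (leftOf (x , y))) ℕ.+ length (filter new? ((suc x , y) ∷ verticals (x , y)))
        ≡⟨ cong₂ ℕ._+_ (count-left x) (trans (count-∷ (suc x) y _) (cong (free (V (2 ℕ.+ x) y) ℕ.+_) (vertical (allFin h)))) ⟩
      degree (V x) (V (2 ℕ.+ x) y) (V (suc x)) y ∎
      where
      new? = λ u → ¬? (u ∈? vs)
      count-∷ : ∀ x y us → length (filter new? ((x , y) ∷ us)) ≡ free (V (suc x) y) ℕ.+ length (filter new? us)
      count-∷ x y us rewrite R .inner x y with does ((x , y) ∈? vs)
      ... | true  = refl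
      ... | false = refl
      count-left : ∀ x → length (filter new? (leftOf (x , y))) ≡ free (V x y)
      count-left zero    rewrite R .wall y = refl
      count-left (suc x) = trans (count-∷ x y []) (ℕₚ.+-identityʳ _)
      vertical : ∀ zs → length (filter new? (map (x ,_) (filter (adjacent? y) zs)))
        ≡ length (filterᵇ (λ z → adjacent y z ∧ not (V (suc x) z)) zs)
      vertical []       = refl
      vertical (z ∷ zs) with adjacent y z | V (suc x) z in e
      ... | false | _     = vertical zs
      ... | true  | true  = trans (count-∷ x z _) (cong₂ ℕ._+_ (cong free e) (vertical zs))
      ... | true  | false = trans (count-∷ x z _) (cong₂ ℕ._+_ (cong free e) (vertical zs))

    -- Weighted sums over the listed walks

    weight : List (Vertex h) → ∀ {n} → Vec (Vertex h) (suc n) → K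
    weight vs (v ∷ [])        = 1ᴷ
    weight vs (v ∷ W@(_ ∷ _)) = recip (unvisited (v ∷ vs) v) * weight (v ∷ vs) W

    new : List (Vertex h) → Vertex h → Bool
    new vs v = not (does (v ∈? vs))

    -- Tests self-avoidance and trapping along the walk, against a growing list of visited vertices,
    -- because the recursion of `enter` checks them in this way.
    valid : List (Vertex h) → ∀ {n} → Vec (Vertex h) (suc n) → Bool
    valid vs (v ∷ [])        = new vs v ∧ (unvisited (v ∷ vs) v ≡ᵇ 0)
    valid vs (v ∷ W@(_ ∷ _)) = new vs v ∧ valid (v ∷ vs) W

    maxColumn : ∀ {n} → Vec (Vertex h) (suc n) → ℕ
    maxColumn W = Vec.foldr₁ _⊔_ (Vec.map proj₁ W)

    boundedWeight : ℕ → List (Vertex h) → ∀ {n} → Vec (Vertex h) (suc n) → K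
    boundedWeight m vs W = guard ((maxColumn W <ᵇ m) ∧ valid vs W) (weight vs W)

    ⊔-<ᵇ : ∀ a b m → (a ⊔ b <ᵇ m) ≡ (a <ᵇ m) ∧ (b <ᵇ m)
    ⊔-<ᵇ a b m = does-⇔ (mk⇔
        (λ l → ℕₚ.≤-<-trans (ℕₚ.m≤m⊔n a b) l , ℕₚ.≤-<-trans (ℕₚ.m≤n⊔m a b) l)
        (λ (l , l′) → ℕₚ.⊔-lub l l′))
      (a ⊔ b ℕₚ.<? m) ((a ℕₚ.<? m) ×-dec (b ℕₚ.<? m))

    boundedWeight-∷ : ∀ m vs v {n} (W : Vec (Vertex h) (suc n)) → boundedWeight m vs (v ∷ W) ≡
      guard ((proj₁ v <ᵇ m) ∧ new vs v) (recip (unvisited (v ∷ vs) v) * boundedWeight m (v ∷ vs) W)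
    boundedWeight-∷ m vs v W@(_ ∷ _) = trans
      (cong (λ b → guard (b ∧ (new vs v ∧ valid (v ∷ vs) W)) (r * weight (v ∷ vs) W)) (⊔-<ᵇ (proj₁ v) (maxColumn W) m))
      (rearrange (proj₁ v <ᵇ m) (maxColumn W <ᵇ m) (new vs v) (valid (v ∷ vs) W))
      where
      r = recip (unvisited (v ∷ vs) v)
      rearrange : ∀ a b c d {q} → guard ((a ∧ b) ∧ (c ∧ d)) (r * q) ≡ guard (a ∧ c) (r * guard (b ∧ d) q)
      rearrange true  true  true  d {q} = sym (*-guard r d q)
      rearrange true  true  false d     = refl
      rearrange true  false true  d     = sym (zeroʳ r)
      rearrange true  false false d     = refl
      rearrange false b     c     d     = refl

    -- A walk with `n` edges has `suc n` vertices, and the phantom column shifts both the position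
    -- and the bound by 1. The empty trace keeps the walk off the phantom column.
    ∑-walks : ∀ n m {vs V} → Records vs V → ∀ x y →
      enter (suc m) (suc n) V (suc x) y [] ≡ ∑ (walks n (x , y)) (boundedWeight m vs)
    ∑-walks zero m {vs} {V} R x y = begin
      guard ((x <ᵇ m) ∧ not (V (suc x) y)) (guard (d ≡ᵇ 0) 1ᴷ
          + recip d * (0ᴷ + 0ᴷ + ∑ (allFin h) λ z → guard (adjacent y z) 0ᴷ))
        ≡⟨ cong₂ (λ a b → guard ((x <ᵇ m) ∧ not a) b) (R .inner x y) (dropʳ _ (vanishʳ _
            (trans (dropˡ _ (+-identityˡ 0ᴷ)) (∑-zero (allFin h) λ z → guard-0 (adjacent y z))))) ⟩
      guard ((x <ᵇ m) ∧ new vs v) (guard (d ≡ᵇ 0) 1ᴷ)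
        ≡⟨ cong (λ d → guard ((x <ᵇ m) ∧ new vs v) (guard (d ≡ᵇ 0) 1ᴷ)) (sym (unvisited-degree (records-visit x y R) x y)) ⟩
      guard ((x <ᵇ m) ∧ new vs v) (guard u 1ᴷ)
        ≡⟨ guard-∧ ((x <ᵇ m) ∧ new vs v) u 1ᴷ ⟨
      guard (((x <ᵇ m) ∧ new vs v) ∧ u) 1ᴷ
        ≡⟨ cong (λ b → guard b 1ᴷ) (Boolₚ.∧-assoc (x <ᵇ m) _ _) ⟩
      boundedWeight m vs (v ∷ [])
        ≡⟨ +-identityʳ _ ⟨
      boundedWeight m vs (v ∷ []) + 0ᴷ ∎
      where
      v  = x , y
      V⁺ = visit (suc x) y V
      d  = degree (V⁺ x) (V⁺ (2 ℕ.+ x) y) (V⁺ (suc x)) y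
      u  = unvisited (v ∷ vs) v ≡ᵇ 0
    ∑-walks (suc n) m {vs} {V} R x y = begin
      guard ((x <ᵇ m) ∧ not (V (suc x) y)) (guard (d ≡ᵇ 0) 0ᴷ + recip d *
          (enter (suc m) (suc n) V⁺ x y [] + enter (suc m) (suc n) V⁺ (2 ℕ.+ x) y []
            + ∑ (allFin h) λ z → guard (adjacent y z) (enter (suc m) (suc n) V⁺ (suc x) z [])))
        ≡⟨ cong₂ (λ a b → guard ((x <ᵇ m) ∧ not a) b) (R .inner x y) (trans (dropˡ _ (guard-0 (d ≡ᵇ 0)))
            (cong₂ (λ d q → recip d * q) (sym (unvisited-degree R⁺ x y)) (begin
              enter (suc m) (suc n) V⁺ x y [] + enter (suc m) (suc n) V⁺ (2 ℕ.+ x) y []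
                + (∑ (allFin h) λ z → guard (adjacent y z) (enter (suc m) (suc n) V⁺ (suc x) z []))
                ≡⟨ +-assoc _ _ _ ⟩
              enter (suc m) (suc n) V⁺ x y [] + (enter (suc m) (suc n) V⁺ (2 ℕ.+ x) y []
                + (∑ (allFin h) λ z → guard (adjacent y z) (enter (suc m) (suc n) V⁺ (suc x) z [])))
                ≡⟨ cong₂ _+_ (leftwards x) (cong₂ _+_ (∑-walks n m R⁺ (suc x) y)
                    (∑-cong (allFin h) λ z → cong (guard (adjacent y z)) (∑-walks n m R⁺ x z))) ⟩
              ∑ (leftOf v) φ + (φ (suc x , y) + ∑ (allFin h) λ z → guard (adjacent y z) (φ (x , z)))
                ≡⟨ ∑-neighbours x y φ ⟨
              ∑ (neighbours v) φ
                ≡⟨ ∑-concatMap (neighbours v) (walks n) _ ⟨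
              ∑ ws (boundedWeight m (v ∷ vs)) ∎))) ⟩
      guard ((x <ᵇ m) ∧ new vs v) (r * ∑ ws (boundedWeight m (v ∷ vs)))
        ≡⟨ cong (guard ((x <ᵇ m) ∧ new vs v)) (∑-*ˡ ws r _) ⟨
      guard ((x <ᵇ m) ∧ new vs v) (∑ ws λ W → r * boundedWeight m (v ∷ vs) W)
        ≡⟨ ∑-guard ws ((x <ᵇ m) ∧ new vs v) _ ⟨
      ∑ ws (λ W → guard ((x <ᵇ m) ∧ new vs v) (r * boundedWeight m (v ∷ vs) W))
        ≡⟨ ∑-cong ws (boundedWeight-∷ m vs v) ⟨
      ∑ ws (λ W → boundedWeight m vs (v ∷ W))
        ≡⟨ ∑-map ws (v ∷_) _ ⟨
      ∑ (walks (suc n) v) (boundedWeight m vs) ∎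
      where
      v  = x , y
      V⁺ = visit (suc x) y V
      R⁺ = records-visit x y R
      d  = degree (V⁺ x) (V⁺ (2 ℕ.+ x) y) (V⁺ (suc x)) y
      ws = concatMap (walks n) (neighbours v)
      r  = recip (unvisited (v ∷ vs) v)
      φ : Vertex h → K
      φ u = ∑ (walks n u) (boundedWeight m (v ∷ vs))
      leftwards : ∀ x′ → enter (suc m) (suc n) V⁺ x′ y [] ≡ ∑ (leftOf (x′ , y)) φ
      -- The empty trace forbids a step into the wall, just as `leftOf` is empty in the first column
      -- of the graph.
      leftwards zero     = refl
      leftwards (suc x′) = trans (∑-walks n m R⁺ x′ y) (sym (+-identityʳ _))

    walkSeries-suc : ∀ y n m → walkSeries y (suc n) m ≡ ∑ (walks n (0 , y)) (boundedWeight m [])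
    walkSeries-suc y n m = ∑-walks n m (record { wall = λ _ → refl ; inner = λ _ _ → refl }) 0 y

    -- Being trapped relative to a prefix `vs`, a form that persists when the head of the walk is
    -- moved into `vs`.
    AllVisited : List (Vertex h) → ∀ {n} → Vec (Vertex h) (suc n) → Set
    AllVisited vs W = ∀ u → Adj (Vec.last W) u → u ∈ᵥ W ⊎ u ∈ vs

    valid⁻ : ∀ vs {n} (W : Vec (Vertex h) (suc n)) → valid vs W ≡ true →
      Allᵥ (_∉ vs) W × Uniqueᵥ W × AllVisited vs W
    valid⁻ vs (v ∷ []) e with v ∈? vs | length (filter (λ u → ¬? (u ∈? (v ∷ vs))) (neighbours v)) in z
    ... | no v∉ | zero = v∉ ∷ [] , [] ∷ [] , λ u a → visited u (∈-neighbours⁺ v a)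
      where
      visited : ∀ u → u ∈ neighbours v → u ∈ᵥ (v ∷ []) ⊎ u ∈ vs
      visited u p with u ∈? (v ∷ vs)
      ... | yes (here refl) = inj₁ (here refl)
      ... | yes (there q)   = inj₂ q
      ... | no  u∉          = contradiction (∈-filter⁺ (λ u → ¬? (u ∈? (v ∷ vs))) p u∉)
                                (length≡0 z)
        where
        length≡0 : ∀ {us : List (Vertex h)} {u} → length us ≡ 0 → u ∉ us
        length≡0 {[]} _ ()
    valid⁻ vs (v ∷ W@(_ ∷ _)) e with v ∈? vs
    ... | no v∉ with valid⁻ (v ∷ vs) W e
    ...   | old , unique , visited =
        v∉ ∷ Allᵥ.map (λ u∉ → u∉ ∘ there) old
      , Allᵥ.map (λ u∉ v≡u → u∉ (here (sym v≡u))) old ∷ unique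
      , λ u a → case visited u a of λ where
          (inj₁ p)           → inj₁ (there p)
          (inj₂ (here refl)) → inj₁ (here refl)
          (inj₂ (there p))   → inj₂ p

    valid⁺ : ∀ vs {n} (W : Vec (Vertex h) (suc n)) →
      Allᵥ (_∉ vs) W → Uniqueᵥ W → AllVisited vs W → valid vs W ≡ true
    valid⁺ vs (v ∷ []) (v∉ ∷ []) u visited
      rewrite dec-false (v ∈? vs) v∉
            | Listₚ.filter-none (λ u → ¬? (u ∈? (v ∷ vs))) {xs = neighbours v}
                (All.tabulate λ {u} p u∉ → case visited u (∈-neighbours⁻ v p) of λ where
                  (inj₁ (here e)) → u∉ (here e)
                  (inj₂ q)        → u∉ (there q)) = refl
    valid⁺ vs (v ∷ W@(_ ∷ _)) (v∉ ∷ old) (fresh ∷ unique) visited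
      rewrite dec-false (v ∈? vs) v∉ = valid⁺ (v ∷ vs) W
        (Allᵥ.map (λ (u∉ , v≢u) → λ { (here e) → v≢u (sym e) ; (there p) → u∉ p }) (Allᵥ.zip (old , fresh)))
        unique
        (λ u a → case visited u a of λ where
          (inj₁ (here e))  → inj₂ (here e)
          (inj₁ (there p)) → inj₁ p
          (inj₂ p)         → inj₂ (there p))

    linked : ∀ n v {W} → W ∈ walks n v → Linked Adj W
    linked zero    v (here refl) = [-]
    linked (suc n) v p with ∈-map⁻ (v ∷_) p
    ... | W , q , refl with find (∈-concatMap⁻ (walks n) {xs = neighbours v} q)
    ...   | u , u∈ , r = link W (head-walks n r) (linked n u r)
      where
      link : ∀ (W : Vec (Vertex h) (suc n)) → Vec.head W ≡ u → Linked Adj W → Linked Adj (v ∷ W)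
      link (_ ∷ _) refl l = ∈-neighbours⁻ v u∈ ∷ l

    isGSAW-valid : ∀ n v {W} → W ∈ walks n v → does (isGSAW? v W) ≡ valid [] W
    isGSAW-valid n v {W} p with valid [] W in e
    ... | true  = dec-true (isGSAW? v W) (case valid⁻ [] W e of λ where
        (_ , unique , visited) → mkGSAW (head-walks n p) (linked n v p) unique
          λ u a → case visited u a of λ { (inj₁ q) → q })
    ... | false = dec-false (isGSAW? v W) λ (mkGSAW _ _ unique trapped) → contradiction
        (trans (sym e) (valid⁺ [] W (Allᵥ.universal (λ _ ()) W) unique λ u a → inj₁ (trapped u a))) λ ()

    -- The start lies in column 0, so the smallest column computes to 0.
    displacement-from-0 : ∀ y {n} (W : Vec (Vertex h) (suc n)) → Vec.head W ≡ (0 , y) →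
      displacement W ≡ maxColumn W
    displacement-from-0 y (v ∷ [])    refl = refl
    displacement-from-0 y (v ∷ _ ∷ _) refl = refl

    guard-<ᵇ-suc : ∀ a m q → guard (a ≡ᵇ m) q + guard (a <ᵇ m) q ≡ guard (a <ᵇ suc m) q
    guard-<ᵇ-suc zero    zero    q = +-identityʳ q
    guard-<ᵇ-suc zero    (suc m) q = +-identityˡ q
    guard-<ᵇ-suc (suc a) zero    q = +-identityˡ 0ᴷ
    guard-<ᵇ-suc (suc a) (suc m) q = guard-<ᵇ-suc a m q

    gsawSeries : Row → Series
    gsawSeries y n m = ∑ (filter (λ W → displacement W ℕₚ.≟ m) (gsaws n (0 , y))) (weight [])

    -- For a walk from column 0, a largest column below `suc m` is either equal to `m` or below `m`.
    -- The argument `suc n` converts edges into vertices.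
    gsawSeries-difference : ∀ y n m →
      gsawSeries y n m + walkSeries y (suc n) m ≡ walkSeries y (suc n) (suc m)
    gsawSeries-difference y n m = begin
      gsawSeries y n m + walkSeries y (suc n) m
        ≡⟨ cong₂ _+_ (trans (∑-filter (λ W → displacement W ℕₚ.≟ m) (gsaws n v) (weight []))
                            (∑-filter (isGSAW? v) ws _))
                     (walkSeries-suc y n m) ⟩
      ∑ ws (λ W → guard (does (isGSAW? v W)) (guard (displacement W ≡ᵇ m) (weight [] W))) + ∑ ws (boundedWeight m [])
        ≡⟨ ∑-+ ws _ _ ⟨
      ∑ ws (λ W → guard (does (isGSAW? v W)) (guard (displacement W ≡ᵇ m) (weight [] W)) + boundedWeight m [] W)
        ≡⟨ ∑-cong-∈ ws pointwise ⟩
      ∑ ws (boundedWeight (suc m) [])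
        ≡⟨ walkSeries-suc y n (suc m) ⟨
      walkSeries y (suc n) (suc m) ∎
      where
      v  = 0 , y
      ws = walks n v
      pointwise : ∀ W → W ∈ ws →
        guard (does (isGSAW? v W)) (guard (displacement W ≡ᵇ m) (weight [] W)) + boundedWeight m [] W
        ≡ boundedWeight (suc m) [] W
      pointwise W p rewrite isGSAW-valid n v p | displacement-from-0 y W (head-walks n p)
        with valid [] W
      ... | true rewrite Boolₚ.∧-identityʳ (maxColumn W <ᵇ m) | Boolₚ.∧-identityʳ (maxColumn W <ᵇ suc m) =
        guard-<ᵇ-suc (maxColumn W) m (weight [] W)
      ... | false rewrite Boolₚ.∧-zeroʳ (maxColumn W <ᵇ m) | Boolₚ.∧-zeroʳ (maxColumn W <ᵇ suc m) = +-identityˡ 0ᴷ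

    gsawSeries-rational : ∀ y → ∃₂ λ Q P → Polynomial Q × Polynomial P × Q 1 1 ≡ 1ᴷ × Q ⊛ gsawSeries y ≋ P
    gsawSeries-rational y = rational-difference (walkSeries-rational y) (λ _ → refl)
      (λ { zero → refl ; (suc n) → refl }) (gsawSeries-difference y)

-- Specialisation to rational coefficients and reciprocal weights

open TransferMatrix ℚₚ.+-*-isCommutativeRing

weight≡probFrom : ∀ {h} vs {n} (W : Vec (Vertex h) (suc n)) → weight (reciprocal {h}) h vs W ≡ probFrom vs W
weight≡probFrom vs (v ∷ [])            = refl
weight≡probFrom {h} vs (v ∷ W@(_ ∷ _)) =
  cong (reciprocal {h} (unvisited (v ∷ vs) v) ℚ.*_) (weight≡probFrom (v ∷ vs) W)

fᵁ≈gsawSeries : ∀ k → fᵁ (suc k) ≈ gsawSeries (reciprocal {suc k}) (suc k) (fromℕ k)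
fᵁ≈gsawSeries k n m = ∑-cong (filter (λ W → displacement W ℕₚ.≟ m) (gsaws n (0 , fromℕ k)))
  {uniformProb} {weight (reciprocal {suc k}) (suc k) []} λ W → sym (weight≡probFrom [] W)

isRational : ∀ {F G} → F ≈ G →
  (∃₂ λ Q P → Polynomial Q × Polynomial P × Q 1 1 ≡ 1ℚ × Q ⊛ G ≋ P) → IsRational F
isRational F≈G (Q , P , polyQ , polyP , Q≡1 , QG≋P) = P , Q , polyP , polyQ
  , (λ Q≈0 → contradiction (trans (sym Q≡1) (Q≈0 1 1)) λ ())
  , λ n m → trans (⊛-congʳ Q F≈G n m) (QG≋P n m)

theorem5p1 : ∀ (h : ℕ) .{{_ : NonZero h}} → IsRational (fᵁ h)
theorem5p1 (suc k) = isRational (fᵁ≈gsawSeries k) (gsawSeries-rational (reciprocal {suc k}) (suc k) (fromℕ k))
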